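{- (1) If $n\ge 4$ and $R\ge 1$ are integers such that $R\not\longrightarrow (n-1)^2_2$, then $\mathrm{L}^{(2)}(n)>2^{R}$. (2) If $n\ge k\ge 3$ are integers, then $\mathrm{L}^{(k)}(4n+k)>2^{\mathrm{L}^{(k-1)}(n)-1}$.
   Context: For a natural number $N$ let $[N]=\{1,\dots,N\}$, and for a set $X$ let $X^{(k)}$ be the set of all $k$-element subsets of $X$. The negative partition relation $R\not\longrightarrow (q)^2_2$ means that there exists a colouring of $[R]^{(2)}$ with $2$ colours for which there is no set $X\subseteq[R]$ of size $q$ with $X^{(2)}$ monochromatic. An ordering means a (strict) linear ordering. For a set $X$ of integers, an ordering $(X^{(k)},\prec)$ is canonical if for any two (finite) sets $A,B\subseteq X$ of the same size the order-preserving map from $A$ to $B$ (with respect to the usual order of the integers) induces an order-preserving map from $(A^{(k)},\prec)$ to $(B^{(k)},\prec)$. For positive integers $k,n$, $\mathrm{L}^{(k)}(n)$ denotes the least integer such that for every $N\ge \mathrm{L}^{(k)}(n)$ and every ordering $([N]^{(k)},\prec)$ there is a set $X\subseteq[N]$ of size $n$ such that $(X^{(k)},\prec)$ is canonical. (Such an integer exists by a theorem of Leeb.) -}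

module Defs where

open import Data.Nat.Base using (ℕ; _≤_)
open import Data.Fin.Base using (Fin) renaming (_<_ to _<ᶠ_)
open import Data.Fin.Subset using (Subset; _∈_; _⊆_; ∣_∣)
open import Data.Product.Base using (Σ-syntax; ∃-syntax; _×_; proj₁)
open import Function.Bundles using (_⇔_)
open import Level using (0ℓ)
open import Relation.Binary.Core using (Rel)
open import Relation.Binary.Structures using (IsStrictTotalOrder)
open import Relation.Binary.PropositionalEquality.Core using (_≡_)
open import Relation.Nullary.Negation.Core using (¬_)

-- [N]⁽ᵏ⁾.  The set [N] = {1,…,N} is represented by Fin N, with the usual order.

[_]⁽_⁾ : ℕ → ℕ → Set
[ N ]⁽ k ⁾ = Σ[ S ∈ Subset N ] ∣ S ∣ ≡ k

Monochromatic : ∀ {R} → ([ R ]⁽ 2 ⁾ → Fin 2) → Subset R → Set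
Monochromatic {R} c X =
  ∃[ i ] ((S : [ R ]⁽ 2 ⁾) → proj₁ S ⊆ X → c S ≡ i)

-- R ↛⟨ q ⟩²₂ is the negative partition relation R ⟶̸ (q)²₂.

infix 4 _↛⟨_⟩²₂

_↛⟨_⟩²₂ : ℕ → ℕ → Set
R ↛⟨ q ⟩²₂ =
  Σ[ c ∈ ([ R ]⁽ 2 ⁾ → Fin 2) ]
    ¬ (Σ[ X ∈ Subset R ] ∣ X ∣ ≡ q × Monochromatic c X)

-- f maps A into B preserving the strict order.  When ∣ A ∣ ≡ ∣ B ∣, the
-- restriction of such an f to A is the unique order-preserving map from A to B
-- (values of f outside A are irrelevant).

OrderPreserving : ∀ {N} → Subset N → Subset N → (Fin N → Fin N) → Set
OrderPreserving A B f =
    (∀ {i} → i ∈ A → f i ∈ B)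
  × (∀ {i j} → i ∈ A → j ∈ A → i <ᶠ j → f i <ᶠ f j)

-- T = f[S], the image of S under f.

IsImage : ∀ {N} → (Fin N → Fin N) → Subset N → Subset N → Set
IsImage f S T = ∀ j → (j ∈ T) ⇔ (∃[ i ] (i ∈ S × f i ≡ j))

-- (X⁽ᵏ⁾, ≺) is canonical, where ≺ on X⁽ᵏ⁾ is the restriction of ≺ on [N]⁽ᵏ⁾.
-- S and S′ range over A⁽ᵏ⁾.  Since f is injective on A, the k-sets T = f[S] and
-- T′ = f[S′] in B⁽ᵏ⁾ always exist and are determined by S and S′.

Canonical : ∀ {N k} → Rel [ N ]⁽ k ⁾ 0ℓ → Subset N → Set
Canonical {N} {k} _≺_ X =
  (A B : Subset N) → A ⊆ X → B ⊆ X → ∣ A ∣ ≡ ∣ B ∣ →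
  (f : Fin N → Fin N) → OrderPreserving A B f →
  (S S′ T T′ : [ N ]⁽ k ⁾) → proj₁ S ⊆ A → proj₁ S′ ⊆ A →
  IsImage f (proj₁ S) (proj₁ T) → IsImage f (proj₁ S′) (proj₁ T′) →
  S ≺ S′ → T ≺ T′

HasCanonicalSubsets : (k n N : ℕ) → Set₁
HasCanonicalSubsets k n N =
  (_≺_ : Rel [ N ]⁽ k ⁾ 0ℓ) → IsStrictTotalOrder _≡_ _≺_ →
  Σ[ X ∈ Subset N ] ∣ X ∣ ≡ n × Canonical _≺_ X

-- ℓ is the least m such that every N ≥ m has the property above; that is,
-- ℓ = L⁽ᵏ⁾(n).  L is given by its graph because the existence of the least such
-- m for all k, n ≥ 1 is a theorem of Leeb.

IsL : (k n ℓ : ℕ) → Set₁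
IsL k n ℓ = Good ℓ × (∀ m → Good m → ℓ ≤ m)
  where
  Good : ℕ → Set₁
  Good m = ∀ N → m ≤ N → HasCanonicalSubsets k n N

{-# OPTIONS --safe #-}
module Submission where

-- Identify [2ᴹ] with the binary strings of length M in lexicographic order and let
-- δ(x,y) be the first position where x and y differ.  If all triples x < y < z of a set
-- satisfy δ(x,y) < δ(y,z), or all satisfy δ(x,y) > δ(y,z), the set is a comb: a set of
-- m + 1 vertices has m distinct depths, and these determine all values of δ on it.
--
-- (1) Order pairs by δ first.  Comparing xy with yz, a canonical set is a comb.  Pairs of
-- equal depth d are compared in the lexicographic order that is reversed at the levels e
-- with {d,e} of colour 1, so that comparing two sides of a triple which have equal depth
-- reveals the colour of {δ(x,y), δ(y,z)}; hence the n − 1 depths are monochromatic.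
--
-- (2) Order k-sets first by whether δ(x₁,x₂) < δ(x₂,x₃), then by their set of depths
-- according to the given ordering.  In a canonical set the first key is constant on one of
-- any two separated blocks, which makes this block without its last k − 3 elements a comb.
-- A set S of depths is then the depth set of the k-set consisting of one extreme vertex and
-- the vertices branching off at the depths in S, so the depths form a canonical set.

open import Defs
open import Data.Bool.Base as Bool using (Bool; true; false; not; _xor_)
import Data.Bool.Properties as Bool
open import Data.Fin.Base as Fin using (Fin; zero; suc; toℕ; inject₁; fromℕ; opposite; combine; remQuot;
  _↑ˡ_; _↑ʳ_; splitAt) renaming (_<_ to _<ᶠ_)
import Data.Fin.Properties as Fin
open import Data.Fin.Induction using (<-weakInduction)
open import Data.Fin.Subset using (Subset; inside; outside; _∈_; _⊆_; ∣_∣)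
open import Data.Fin.Subset.Properties using (_∈?_; ⊆-antisym; p⊂q⇒∣p∣<∣q∣; anySubset?; _⊆?_)
open import Data.Nat.Base using (ℕ; zero; suc; _+_; _*_; _∸_; _^_; _≤_; _<_; _>_; z≤n; s≤s)
import Data.Nat.Properties as ℕ
open import Data.Nat.Solver using (module +-*-Solver)
open import Data.Product.Base using (Σ-syntax; ∃-syntax; _×_; _,_; proj₁; proj₂)
open import Data.Product.Relation.Binary.Lex.Strict using (×-Lex; ×-isStrictTotalOrder)
open import Data.Product.Relation.Binary.Pointwise.NonDependent using (Pointwise)
open import Data.Sum.Base using (_⊎_; inj₁; inj₂; swap)
open import Data.Vec.Base using (Vec; []; _∷_; tabulate; lookup; zipWith; here; there)
open import Data.Vec.Properties using (lookup∘tabulate; []=⇒lookup; lookup⇒[]=)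
open import Data.Vec.Functional using (Vector) renaming (_∷_ to _◂_; [] to ⟨⟩; _++_ to _⧺_)
open import Data.Vec.Functional.Properties using (lookup-++ˡ; lookup-++ʳ)
open import Function.Base using (_∘_; _on_)
open import Function.Bundles using (mk⇔; Equivalence)
open import Function.Definitions using (Injective)
open import Level using (0ℓ)
import Relation.Binary.Construct.Add.Infimum.Strict as Infimum
open import Relation.Binary.Core using (Rel)
open import Relation.Binary.Definitions using (Trichotomous; Transitive; tri<; tri≈; tri>)
open import Relation.Binary.PropositionalEquality
open import Relation.Binary.Structures using (IsStrictTotalOrder)
open import Relation.Binary.Structures.Biased using (isStrictTotalOrderᶜ)
open import Relation.Nullary using (¬_; Dec; yes; no; does; contradiction)
open import Relation.Nullary.Construct.Add.Infimum using (_₋; ⊥₋; [_]; []-injective)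
open import Relation.Nullary.Decidable using (_×-dec_; map′; dec-true)
open import Relation.Unary using (Decidable)

-- Increasing maps between initial segments

Increasing : ∀ {m N} → (Fin m → Fin N) → Set
Increasing h = ∀ i j → i <ᶠ j → h i <ᶠ h j

increasing⇒injective : ∀ {m N} {h : Fin m → Fin N} → Increasing h → Injective _≡_ _≡_ h
increasing⇒injective h-inc {i} {j} hi≡hj with Fin.<-cmp i j
... | tri< i<j _ _ = contradiction hi≡hj (Fin.<⇒≢ (h-inc i j i<j))
... | tri≈ _ i≡j _ = i≡j
... | tri> _ _ j<i = contradiction (sym hi≡hj) (Fin.<⇒≢ (h-inc j i j<i))

increasing-reflects-< : ∀ {m N} {h : Fin m → Fin N} → Increasing h → ∀ i j → h i <ᶠ h j → i <ᶠ j
increasing-reflects-< {h = h} h-inc i j hi<hj with Fin.<-cmp i j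
... | tri< i<j _ _ = i<j
... | tri≈ _ refl _ = contradiction hi<hj (Fin.<-irrefl {x = h i} refl)
... | tri> _ _ j<i = contradiction hi<hj (Fin.<-asym (h-inc j i j<i))

increasing-≥ : ∀ {m N} {h : Fin m → Fin N} → Increasing h → ∀ i → toℕ i ≤ toℕ (h i)
increasing-≥ {suc m} {h = h} h-inc = <-weakInduction (λ i → toℕ i ≤ toℕ (h i)) z≤n step
  where
  inject₁<suc : ∀ (i : Fin m) → inject₁ i <ᶠ suc i
  inject₁<suc i = s≤s (ℕ.≤-reflexive (Fin.toℕ-inject₁ i))
  step : ∀ i → toℕ (inject₁ i) ≤ toℕ (h (inject₁ i)) → toℕ (suc i) ≤ toℕ (h (suc i))
  step i i≤hi = ℕ.≤-<-trans (subst (_≤ toℕ (h (inject₁ i))) (Fin.toℕ-inject₁ i) i≤hi)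
                            (h-inc (inject₁ i) (suc i) (inject₁<suc i))

opposite-< : ∀ {m} (i j : Fin m) → i <ᶠ j → opposite j <ᶠ opposite i
opposite-< i j i<j =
  subst₂ _<_ (sym (Fin.opposite-prop j)) (sym (Fin.opposite-prop i))
    (ℕ.∸-monoʳ-< (s≤s i<j) (Fin.toℕ<n j))

-- By `increasing-≥` such a map moves no element down; the same bound for its conjugate by
-- `opposite` shows that it moves none up.
increasing-self⇒id : ∀ {m} {r : Fin m → Fin m} → Increasing r → ∀ i → r i ≡ i
increasing-self⇒id {r = r} r-inc i with Fin.<-cmp (r i) i
... | tri< ri<i _ _ = contradiction (increasing-≥ r-inc i) (ℕ.<⇒≱ ri<i)
... | tri≈ _ ri≡i _ = ri≡i
... | tri> _ _ i<ri = contradiction lower (ℕ.<⇒≱ (opposite-< i (r i) i<ri))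
  where
  mirror-inc : Increasing (opposite ∘ r ∘ opposite)
  mirror-inc x y x<y = opposite-< _ _ (r-inc _ _ (opposite-< x y x<y))
  lower : toℕ (opposite i) ≤ toℕ (opposite (r i))
  lower = subst (λ x → toℕ (opposite i) ≤ toℕ (opposite (r x))) (Fin.opposite-involutive i)
            (increasing-≥ mirror-inc (opposite i))

◂-increasing : ∀ {m N} {x : Fin N} {h : Fin m → Fin N} →
  (∀ j → x <ᶠ h j) → Increasing h → Increasing (x ◂ h)
◂-increasing x<h h-inc zero    (suc j) _         = x<h j
◂-increasing x<h h-inc (suc i) (suc j) (s≤s i<j) = h-inc i j i<j

-- Enumeration and counting

enum : ∀ {N} (S : Subset N) → Fin ∣ S ∣ → Fin N
enum (outside ∷ S) i       = suc (enum S i)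
enum (inside  ∷ S) zero    = zero
enum (inside  ∷ S) (suc i) = suc (enum S i)

enum-increasing : ∀ {N} (S : Subset N) → Increasing (enum S)
enum-increasing (outside ∷ S) i       j       i<j       = s≤s (enum-increasing S i j i<j)
enum-increasing (inside  ∷ S) zero    (suc j) _         = s≤s z≤n
enum-increasing (inside  ∷ S) (suc i) (suc j) (s≤s i<j) = s≤s (enum-increasing S i j i<j)

enum-∈ : ∀ {N} (S : Subset N) i → enum S i ∈ S
enum-∈ (outside ∷ S) i       = there (enum-∈ S i)
enum-∈ (inside  ∷ S) zero    = here
enum-∈ (inside  ∷ S) (suc i) = there (enum-∈ S i)

enum-surjective : ∀ {N} (S : Subset N) {x} → x ∈ S → ∃[ i ] enum S i ≡ x
enum-surjective (inside  ∷ S) here        = zero , refl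
enum-surjective (outside ∷ S) (there x∈S) with i , refl ← enum-surjective S x∈S = i , refl
enum-surjective (inside  ∷ S) (there x∈S) with i , refl ← enum-surjective S x∈S = suc i , refl

injective⇒≤∣S∣ : ∀ {m N} (S : Subset N) {h : Fin m → Fin N} → Injective _≡_ _≡_ h →
  (∀ i → h i ∈ S) → m ≤ ∣ S ∣
injective⇒≤∣S∣ S {h} h-inj h∈S = Fin.injective⇒≤ {f = rank} rank-inj
  where
  rank = λ i → proj₁ (enum-surjective S (h∈S i))
  rank-inj : Injective _≡_ _≡_ rank
  rank-inj {i} {j} eq = h-inj (trans (sym (proj₂ (enum-surjective S (h∈S i))))
    (trans (cong (enum S) eq) (proj₂ (enum-surjective S (h∈S j)))))

comprehension : ∀ {N} {P : Fin N → Set} → Decidable P → Subset N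
comprehension P? = tabulate (does ∘ P?)

∈-comprehension⁺ : ∀ {N} {P : Fin N → Set} (P? : Decidable P) {x} → P x → x ∈ comprehension P?
∈-comprehension⁺ P? {x} Px =
  lookup⇒[]= x _ (trans (lookup∘tabulate (does ∘ P?) x) (dec-true (P? x) Px))

∈-comprehension⁻ : ∀ {N} {P : Fin N → Set} (P? : Decidable P) {x} → x ∈ comprehension P? → P x
∈-comprehension⁻ P? {x} x∈ with P? x | trans (sym (lookup∘tabulate (does ∘ P?) x)) ([]=⇒lookup x∈)
... | yes Px | _ = Px

range : ∀ {m N} → (Fin m → Fin N) → Subset N
range h = comprehension (λ x → Fin.any? (λ i → h i Fin.≟ x))

∈-range⁺ : ∀ {m N} (h : Fin m → Fin N) i → h i ∈ range h
∈-range⁺ h i = ∈-comprehension⁺ (λ x → Fin.any? (λ i → h i Fin.≟ x)) (i , refl)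

∈-range⁻ : ∀ {m N} (h : Fin m → Fin N) {x} → x ∈ range h → ∃[ i ] h i ≡ x
∈-range⁻ h = ∈-comprehension⁻ (λ x → Fin.any? (λ i → h i Fin.≟ x))

range-⊆ : ∀ {m N} {h : Fin m → Fin N} {X : Subset N} → (∀ i → h i ∈ X) → range h ⊆ X
range-⊆ {h = h} h∈X x∈ with i , refl ← ∈-range⁻ h x∈ = h∈X i

∣range∣ : ∀ {m N} {h : Fin m → Fin N} → Injective _≡_ _≡_ h → ∣ range h ∣ ≡ m
∣range∣ {h = h} h-inj = ℕ.≤-antisym (Fin.injective⇒≤ {f = preimage} preimage-inj)
                                    (injective⇒≤∣S∣ (range h) h-inj (∈-range⁺ h))
  where
  R = range h
  preimage = λ i → proj₁ (∈-range⁻ h (enum-∈ R i))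
  preimage-inj : Injective _≡_ _≡_ preimage
  preimage-inj {i} {j} eq = increasing⇒injective (enum-increasing R)
    (trans (sym (proj₂ (∈-range⁻ h (enum-∈ R i))))
    (trans (cong h eq) (proj₂ (∈-range⁻ h (enum-∈ R j)))))

⊆∧∣∣≡⇒≡ : ∀ {N} {p q : Subset N} → p ⊆ q → ∣ p ∣ ≡ ∣ q ∣ → p ≡ q
⊆∧∣∣≡⇒≡ {p = p} p⊆q ∣p∣≡∣q∣ = ⊆-antisym p⊆q (back _)
  where
  back : ∀ x → x ∈ _ → x ∈ p
  back x x∈q with x ∈? p
  ... | yes x∈p = x∈p
  ... | no  x∉p = contradiction ∣p∣≡∣q∣ (ℕ.<⇒≢ (p⊂q⇒∣p∣<∣q∣ (p⊆q , x , x∈q , x∉p)))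

kset-≡ : ∀ {N k} {S T : [ N ]⁽ k ⁾} → proj₁ S ≡ proj₁ T → S ≡ T
kset-≡ {S = S , p} {T = .S , q} refl = cong (S ,_) (ℕ.≡-irrelevant p q)

kset : ∀ {N k} (h : Fin k → Fin N) → Injective _≡_ _≡_ h → [ N ]⁽ k ⁾
kset h h-inj = range h , ∣range∣ h-inj

kset-unique : ∀ {N k} {h : Fin k → Fin N} (h-inj : Injective _≡_ _≡_ h) (S : [ N ]⁽ k ⁾) →
  (∀ i → h i ∈ proj₁ S) → kset h h-inj ≡ S
kset-unique {h = h} h-inj (S , ∣S∣≡k) h∈S =
  kset-≡ (⊆∧∣∣≡⇒≡ (range-⊆ {h = h} h∈S) (trans (∣range∣ h-inj) (sym ∣S∣≡k)))

elems : ∀ {N k} → [ N ]⁽ k ⁾ → Fin k → Fin N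
elems (S , refl) = enum S

elems-increasing : ∀ {N k} (S : [ N ]⁽ k ⁾) → Increasing (elems S)
elems-increasing (S , refl) = enum-increasing S

elems-∈ : ∀ {N k} (S : [ N ]⁽ k ⁾) i → elems S i ∈ proj₁ S
elems-∈ (S , refl) = enum-∈ S

elems-surjective : ∀ {N k} (S : [ N ]⁽ k ⁾) {x} → x ∈ proj₁ S → ∃[ i ] elems S i ≡ x
elems-surjective (S , refl) = enum-surjective S

elems-injective : ∀ {N k} (S : [ N ]⁽ k ⁾) → Injective _≡_ _≡_ (elems S)
elems-injective S = increasing⇒injective (elems-increasing S)

-- The rank of `h i` in `S` is an increasing self-map of `Fin k`, hence the identity.
elems-unique : ∀ {N k} (S : [ N ]⁽ k ⁾) {h : Fin k → Fin N} → Increasing h →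
  (∀ i → h i ∈ proj₁ S) → ∀ i → elems S i ≡ h i
elems-unique S {h} h-inc h∈S i = trans (cong (elems S) (sym (increasing-self⇒id rank-inc i))) (elems-rank i)
  where
  rank = λ i → proj₁ (elems-surjective S (h∈S i))
  elems-rank : ∀ i → elems S (rank i) ≡ h i
  elems-rank i = proj₂ (elems-surjective S (h∈S i))
  rank-inc : Increasing rank
  rank-inc i j i<j = increasing-reflects-< (elems-increasing S) _ _
    (subst₂ _<ᶠ_ (sym (elems-rank i)) (sym (elems-rank j)) (h-inc i j i<j))

injective⇒surjective : ∀ {N k} (S : [ N ]⁽ k ⁾) {h : Fin k → Fin N} → Injective _≡_ _≡_ h →
  (∀ i → h i ∈ proj₁ S) → ∀ {x} → x ∈ proj₁ S → ∃[ i ] h i ≡ x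
injective⇒surjective S {h} h-inj h∈S x∈S =
  ∈-range⁻ h (subst (λ T → _ ∈ proj₁ T) (sym (kset-unique h-inj S h∈S)) x∈S)

-- Canonicity

-- `Canonical` quantifies over total maps, while the maps of interest are prescribed only at the
-- listed points `α i`; `b` is the default elsewhere.
extension : ∀ {a N} {B : Set} (α : Fin a → Fin N) (β : Fin a → B) → B → Fin N → B
extension α β b x with Fin.any? (λ i → α i Fin.≟ x)
... | yes (i , _) = β i
... | no _        = b

extension-β : ∀ {a N} {B : Set} {α : Fin a → Fin N} → Injective _≡_ _≡_ α →
  (β : Fin a → B) (b : B) → ∀ i → extension α β b (α i) ≡ β i
extension-β {α = α} α-inj β b i with Fin.any? (λ j → α j Fin.≟ α i)
... | yes (j , eq) = cong β (α-inj eq)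
... | no  ∄        = contradiction (i , refl) ∄

-- The form in which canonicity is applied: `α` lists a set, `β` its image, and `h`, `h′` select
-- k-sets by position. The lists may be in any order as long as `β` follows the order of `α`, so an
-- apex can be listed first whether it is the smallest or the largest vertex. Membership of the
-- selected points suffices, since k distinct points exhaust a k-set.
transfer : ∀ {N k a} {_≺_ : Rel [ N ]⁽ k ⁾ 0ℓ} {X} → Canonical _≺_ X →
  {α β : Fin a → Fin N} → (∀ i → α i ∈ X) → (∀ i → β i ∈ X) → Injective _≡_ _≡_ α →
  (∀ i j → α i <ᶠ α j → β i <ᶠ β j) →
  {h h′ : Fin k → Fin a} → Injective _≡_ _≡_ h → Injective _≡_ _≡_ h′ →
  {S S′ T T′ : [ N ]⁽ k ⁾} →
  (∀ t → α (h  t) ∈ proj₁ S)  → (∀ t → β (h  t) ∈ proj₁ T) →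
  (∀ t → α (h′ t) ∈ proj₁ S′) → (∀ t → β (h′ t) ∈ proj₁ T′) →
  S ≺ S′ → T ≺ T′
transfer {N} {k} {a} {X = X} canonical {α} {β} α∈X β∈X α-inj mono {h} {h′} h-inj h′-inj
         {S} {S′} {T} {T′} α∈S β∈T α∈S′ β∈T′ =
  canonical (range α) (range β) (range-⊆ {h = α} α∈X) (range-⊆ {h = β} β∈X)
    (trans (∣range∣ α-inj) (sym (∣range∣ β-inj))) f (f∈ , f-mono) S S′ T T′
    (S⊆ {U = S} h-inj α∈S) (S⊆ {U = S′} h′-inj α∈S′) (image {U = S} {T} h-inj α∈S β∈T)
    (image {U = S′} {T′} h′-inj α∈S′ β∈T′)
  where
  f : Fin N → Fin N
  f x = extension α β x x
  f-α : ∀ i → f (α i) ≡ β i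
  f-α i = extension-β α-inj β (α i) i
  β-inj : Injective _≡_ _≡_ β
  β-inj {i} {j} βi≡βj with Fin.<-cmp (α i) (α j)
  ... | tri< αi<αj _ _ = contradiction βi≡βj (Fin.<⇒≢ (mono i j αi<αj))
  ... | tri≈ _ αi≡αj _ = α-inj αi≡αj
  ... | tri> _ _ αj<αi = contradiction (sym βi≡βj) (Fin.<⇒≢ (mono j i αj<αi))
  f∈ : ∀ {x} → x ∈ range α → f x ∈ range β
  f∈ x∈ with i , refl ← ∈-range⁻ α x∈ = subst (_∈ range β) (sym (f-α i)) (∈-range⁺ β i)
  f-mono : ∀ {x y} → x ∈ range α → y ∈ range α → x <ᶠ y → f x <ᶠ f y
  f-mono x∈ y∈ x<y with i , refl ← ∈-range⁻ α x∈ | j , refl ← ∈-range⁻ α y∈ =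
    subst₂ _<ᶠ_ (sym (f-α i)) (sym (f-α j)) (mono i j x<y)
  S⊆ : ∀ {g : Fin k → Fin a} {U : [ N ]⁽ k ⁾} → Injective _≡_ _≡_ g →
    (∀ t → α (g t) ∈ proj₁ U) → proj₁ U ⊆ range α
  S⊆ {g} {U} g-inj α∈U x∈U
    with t , refl ← injective⇒surjective U (g-inj ∘ α-inj) α∈U x∈U = ∈-range⁺ α (g t)
  image : ∀ {g : Fin k → Fin a} {U V : [ N ]⁽ k ⁾} → Injective _≡_ _≡_ g →
    (∀ t → α (g t) ∈ proj₁ U) → (∀ t → β (g t) ∈ proj₁ V) → IsImage f (proj₁ U) (proj₁ V)
  image {g} {U} {V} g-inj α∈U β∈V y = mk⇔ to from
    where
    to : y ∈ proj₁ V → ∃[ x ] (x ∈ proj₁ U × f x ≡ y)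
    to y∈V with t , refl ← injective⇒surjective V (g-inj ∘ β-inj) β∈V y∈V =
      α (g t) , α∈U t , f-α (g t)
    from : ∃[ x ] (x ∈ proj₁ U × f x ≡ y) → y ∈ proj₁ V
    from (x , x∈U , refl) with t , refl ← injective⇒surjective U (g-inj ∘ α-inj) α∈U x∈U =
      subst (_∈ proj₁ V) (sym (f-α (g t))) (β∈V t)
-- Binary strings and the depth at which two of them split

-- The index is the depth δ. The fork is oriented, so a split also records which string is
-- lexicographically smaller.
data Split : ∀ {M} → Fin M → Vec Bool M → Vec Bool M → Set where
  fork : ∀ {M} {u v : Vec Bool M} → Split zero (false ∷ u) (true ∷ v)
  skip : ∀ {M d b} {u v : Vec Bool M} → Split d u v → Split (suc d) (b ∷ u) (b ∷ v)

Split-irrefl : ∀ {M d} {u : Vec Bool M} → ¬ Split d u u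
Split-irrefl (skip s) = Split-irrefl s

Split-asym : ∀ {M d e} {u v : Vec Bool M} → Split d u v → ¬ Split e v u
Split-asym (skip s) (skip t) = Split-asym s t

Split-unique : ∀ {M d e} {u v : Vec Bool M} → Split d u v → Split e u v → d ≡ e
Split-unique fork     fork     = refl
Split-unique (skip s) (skip t) = cong suc (Split-unique s t)

-- The pair that splits later still agrees at the smaller depth, so the outer pair inherits the
-- split there.
Split-trans-< : ∀ {M d e} {u v w : Vec Bool M} → Split d u v → Split e v w → d <ᶠ e → Split d u w
Split-trans-< fork     (skip t) _         = fork
Split-trans-< (skip s) (skip t) (s≤s d<e) = skip (Split-trans-< s t d<e)

Split-trans-> : ∀ {M d e} {u v w : Vec Bool M} → Split d u v → Split e v w → e <ᶠ d → Split e u w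
Split-trans-> (skip s) fork     _         = fork
Split-trans-> (skip s) (skip t) (s≤s e<d) = skip (Split-trans-> s t e<d)

-- At a common depth the middle string would have to carry both bits.
Split-≢ : ∀ {M d e} {u v w : Vec Bool M} → Split d u v → Split e v w → d ≢ e
Split-≢ (skip s) (skip t) refl = Split-≢ s t refl

split? : ∀ {M} (d : Fin M) (u v : Vec Bool M) → Dec (Split d u v)
split? zero    (false ∷ u) (true  ∷ v) = yes fork
split? zero    (false ∷ u) (false ∷ v) = no λ ()
split? zero    (true  ∷ u) (_     ∷ v) = no λ ()
split? (suc d) (false ∷ u) (false ∷ v) = map′ skip (λ where (skip s) → s) (split? d u v)
split? (suc d) (true  ∷ u) (true  ∷ v) = map′ skip (λ where (skip s) → s) (split? d u v)
split? (suc d) (false ∷ u) (true  ∷ v) = no λ ()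
split? (suc d) (true  ∷ u) (false ∷ v) = no λ ()

infix 4 _<ₗ_

_<ₗ_ : ∀ {M} → Rel (Vec Bool M) 0ℓ
u <ₗ v = ∃[ d ] Split d u v

<ₗ-trans : ∀ {M} → Transitive (_<ₗ_ {M})
<ₗ-trans (d , s) (e , t) with Fin.<-cmp d e
... | tri< d<e _ _  = d , Split-trans-< s t d<e
... | tri≈ _ refl _ = contradiction refl (Split-≢ s t)
... | tri> _ _ e<d  = e , Split-trans-> s t e<d

∷-<ₗ⁻ : ∀ {M b} {u v : Vec Bool M} → b ∷ u <ₗ b ∷ v → u <ₗ v
∷-<ₗ⁻ (_ , skip s) = _ , s

<ₗ-compare : ∀ {M} → Trichotomous _≡_ (_<ₗ_ {M})
<ₗ-compare []      []      = tri≈ (λ ()) refl (λ ())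
<ₗ-compare (b ∷ u) (c ∷ v) with b Bool.≟ c
<ₗ-compare (false ∷ u) (false ∷ v) | no b≢b = contradiction refl b≢b
<ₗ-compare (false ∷ u) (true  ∷ v) | no _   = tri< (zero , fork) (λ ()) (λ where (_ , ()))
<ₗ-compare (true  ∷ u) (false ∷ v) | no _   = tri> (λ where (_ , ())) (λ ()) (zero , fork)
<ₗ-compare (true  ∷ u) (true  ∷ v) | no b≢b = contradiction refl b≢b
... | yes refl with <ₗ-compare u v
...   | tri< (d , s) u≢v v≮u  = tri< (suc d , skip s) (λ where refl → u≢v refl) (v≮u ∘ ∷-<ₗ⁻)
...   | tri≈ u≮v     refl v≮u = tri≈ (u≮v ∘ ∷-<ₗ⁻) refl (v≮u ∘ ∷-<ₗ⁻)
...   | tri> u≮v u≢v (d , s)  = tri> (u≮v ∘ ∷-<ₗ⁻) (λ where refl → u≢v refl) (suc d , skip s)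

<ₗ-isStrictTotalOrder : ∀ {M} → IsStrictTotalOrder _≡_ (_<ₗ_ {M})
<ₗ-isStrictTotalOrder = isStrictTotalOrderᶜ record
  { isEquivalence = isEquivalence
  ; trans         = <ₗ-trans
  ; compare       = <ₗ-compare
  }

bit : Fin 2 → Bool
bit zero       = false
bit (suc zero) = true

-- Most significant bit first, so that the numerical order becomes the lexicographic one.
bits : ∀ M → Fin (2 ^ M) → Vec Bool M
bits zero    _ = []
bits (suc M) x = let q , r = remQuot {2} (2 ^ M) x in bit q ∷ bits M r

splitting : ∀ M (x y : Fin (2 ^ M)) → x <ᶠ y → ∃[ d ] Split d (bits M x) (bits M y)
splitting zero  zero zero ()
splitting (suc M) x    y    x<y =
  go (proj₁ (qr x)) (proj₁ (qr y)) (proj₂ (qr x)) (proj₂ (qr y))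
     (subst₂ _<ᶠ_ (sym (Fin.combine-remQuot {2} (2 ^ M) x)) (sym (Fin.combine-remQuot {2} (2 ^ M) y)) x<y)
  where
  qr : Fin (2 ^ suc M) → Fin 2 × Fin (2 ^ M)
  qr = remQuot (2 ^ M)
  tails : ∀ (q : Fin 2) (r s : Fin (2 ^ M)) → combine q r <ᶠ combine q s → r <ᶠ s
  tails q r s lt = ℕ.+-cancelˡ-< (2 ^ M * toℕ q) _ _
    (subst₂ _<_ (Fin.toℕ-combine q r) (Fin.toℕ-combine q s) lt)
  go : ∀ (p q : Fin 2) (r s : Fin (2 ^ M)) → combine p r <ᶠ combine q s →
       ∃[ d ] Split d (bit p ∷ bits M r) (bit q ∷ bits M s)
  go zero       (suc zero) r s _  = zero , fork
  go (suc zero) zero       r s lt =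
    contradiction lt (Fin.<-asym (Fin.combine-monoˡ-< {m = 2} {i = zero} {j = suc zero} s r (s≤s z≤n)))
  go zero       zero       r s lt = let d , sp = splitting M r s (tails zero r s lt)
                                in suc d , skip sp
  go (suc zero) (suc zero) r s lt = let d , sp = splitting M r s (tails (suc zero) r s lt)
                                in suc d , skip sp

-- Orderings of k-sets by a key

pullback : ∀ {A B : Set} {_≈_ _<′_ : Rel B 0ℓ} → IsStrictTotalOrder _≈_ _<′_ →
  (f : A → B) → (∀ {x y} → f x ≈ f y → x ≡ y) → IsStrictTotalOrder _≡_ (_<′_ on f)
pullback {_≈_ = _≈_} {_<′_} sto f f-inj = isStrictTotalOrderᶜ record
  { isEquivalence = isEquivalence
  ; trans         = λ {x} {y} {z} → sto.trans
  ; compare       = compare′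
  }
  where
  module sto = IsStrictTotalOrder sto
  compare′ : Trichotomous _≡_ (_<′_ on f)
  compare′ x y with sto.compare (f x) (f y)
  ... | tri< lt ≉ ≯ = tri< lt (λ where refl → ≉ sto.Eq.refl) ≯
  ... | tri≈ ≮ ≈ ≯  = tri≈ ≮ (f-inj ≈) ≯
  ... | tri> ≮ ≉ gt = tri> ≮ (λ where refl → ≉ sto.Eq.refl) gt

-- Keys may coincide on different sets; the lexicographic order of characteristic vectors breaks
-- these ties and makes the ordering total.
KeyOrder : ∀ {K : Set} (_≈_ _<′_ : Rel K 0ℓ) {N k} → ([ N ]⁽ k ⁾ → K) → Rel [ N ]⁽ k ⁾ 0ℓ
KeyOrder _≈_ _<′_ κ = ×-Lex _≈_ _<′_ _<ₗ_ on (λ S → κ S , proj₁ S)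

KeyOrder-isStrictTotalOrder : ∀ {K : Set} {_≈_ _<′_ : Rel K 0ℓ} → IsStrictTotalOrder _≈_ _<′_ →
  ∀ {N k} (κ : [ N ]⁽ k ⁾ → K) → IsStrictTotalOrder _≡_ (KeyOrder _≈_ _<′_ κ)
KeyOrder-isStrictTotalOrder sto κ =
  pullback (×-isStrictTotalOrder sto <ₗ-isStrictTotalOrder) (λ S → κ S , proj₁ S)
    (λ where (_ , S≡T) → kset-≡ S≡T)

-- Combs: sequences all of whose triples split in the same direction

Splits : ∀ {M} → Fin M → Rel (Fin (2 ^ M)) 0ℓ
Splits {M} d x y = Split d (bits M x) (bits M y)

Triples : ∀ {M m} → (Fin M → Fin M → Set) → (Fin m → Fin (2 ^ M)) → Set
Triples {M} _∼_ e = ∀ i j l → i <ᶠ j → j <ᶠ l → ∀ {c d : Fin M} →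
  Splits c (e i) (e j) → Splits d (e j) (e l) → c ∼ d

inject₁<fromℕ : ∀ {m} (i : Fin m) → inject₁ i <ᶠ fromℕ m
inject₁<fromℕ {m} i = subst₂ _<_ (sym (Fin.toℕ-inject₁ i)) (sym (Fin.toℕ-fromℕ m)) (Fin.toℕ<n i)

inject₁-< : ∀ {m} (i j : Fin m) → i <ᶠ j → inject₁ i <ᶠ inject₁ j
inject₁-< i j = subst₂ _<_ (sym (Fin.toℕ-inject₁ i)) (sym (Fin.toℕ-inject₁ j))

-- The path to the last vertex is the spine, and `γ i` is the depth at which vertex `i` leaves it.
-- In `LeftComb` the spine leads to the first vertex.
record RightComb {M m} (e : Fin (suc m) → Fin (2 ^ M)) : Set where
  field
    γ       : Fin m → Fin M
    γ-inc   : Increasing γ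
    γ-last  : ∀ i → Splits (γ i) (e (inject₁ i)) (e (fromℕ m))
    γ-split : ∀ i j → i <ᶠ j → Splits (γ i) (e (inject₁ i)) (e (inject₁ j))

record LeftComb {M m} (e : Fin (suc m) → Fin (2 ^ M)) : Set where
  field
    γ       : Fin m → Fin M
    γ-dec   : ∀ i j → i <ᶠ j → γ j <ᶠ γ i
    γ-first : ∀ i → Splits (γ i) (e zero) (e (suc i))
    γ-split : ∀ i j → i <ᶠ j → Splits (γ j) (e (suc i)) (e (suc j))

  γ-injective : Injective _≡_ _≡_ γ
  γ-injective {i} {j} γi≡γj with Fin.<-cmp i j
  ... | tri< i<j _ _ = contradiction (sym γi≡γj) (Fin.<⇒≢ (γ-dec i j i<j))
  ... | tri≈ _ i≡j _ = i≡j
  ... | tri> _ _ j<i = contradiction γi≡γj (Fin.<⇒≢ (γ-dec j i j<i))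

-- Apply the hypothesis to `i`, `j` and the last vertex: the depth of the lower pair is the smaller
-- one, so it is also the depth of the outer pair, which is `γ i`.
rightComb : ∀ {M m} {e : Fin (suc m) → Fin (2 ^ M)} → Increasing e → Triples _<ᶠ_ e → RightComb e
rightComb {M} {m} {e} e-inc right = record
  { γ       = γ
  ; γ-inc   = λ i j i<j → proj₁ (step i j i<j)
  ; γ-last  = γ-last
  ; γ-split = λ i j i<j → proj₂ (step i j i<j)
  }
  where
  spl = λ i → splitting M (e (inject₁ i)) (e (fromℕ m)) (e-inc _ _ (inject₁<fromℕ i))
  γ = proj₁ ∘ spl
  γ-last = proj₂ ∘ spl
  step : ∀ i j → i <ᶠ j → γ i <ᶠ γ j × Splits (γ i) (e (inject₁ i)) (e (inject₁ j))
  step i j i<j with splitting M (e (inject₁ i)) (e (inject₁ j)) (e-inc _ _ (inject₁-< i j i<j))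
  ... | d , s with right _ _ _ (inject₁-< i j i<j) (inject₁<fromℕ j) s (γ-last j)
  ...   | d<γj with refl ← Split-unique (Split-trans-< s (γ-last j) d<γj) (γ-last i) = d<γj , s

-- Symmetrically, with the first vertex added to a pair: the upper pair has the smaller depth, which
-- is therefore that of the outer pair, `γ j`.
leftComb : ∀ {M m} {e : Fin (suc m) → Fin (2 ^ M)} → Increasing e →
  Triples (λ c d → d <ᶠ c) e → LeftComb e
leftComb {M} {m} {e} e-inc left = record
  { γ       = γ
  ; γ-dec   = λ i j i<j → proj₁ (step i j i<j)
  ; γ-first = γ-first
  ; γ-split = λ i j i<j → proj₂ (step i j i<j)
  }
  where
  spl = λ i → splitting M (e zero) (e (suc i)) (e-inc zero (suc i) (s≤s z≤n))
  γ = proj₁ ∘ spl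
  γ-first = proj₂ ∘ spl
  step : ∀ i j → i <ᶠ j → γ j <ᶠ γ i × Splits (γ j) (e (suc i)) (e (suc j))
  step i j i<j with splitting M (e (suc i)) (e (suc j)) (e-inc _ _ (s≤s i<j))
  ... | d , s with left zero (suc i) (suc j) (s≤s z≤n) (s≤s i<j) (γ-first i) s
  ...   | d<γi with refl ← Split-unique (Split-trans-> (γ-first i) s d<γi) (γ-first j) = d<γi , s

-- The lower bound for pairs

pair : ∀ {N} → Fin N → Fin N → Vector (Fin N) 2
pair x y = x ◂ y ◂ ⟨⟩

pair-increasing : ∀ {N} {x y : Fin N} → x <ᶠ y → Increasing (pair x y)
pair-increasing {y = y} x<y =
  ◂-increasing {h = y ◂ ⟨⟩} (λ where zero → x<y) (◂-increasing {h = ⟨⟩} (λ ()) (λ ()))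

pair-injective : ∀ {N} {x y : Fin N} → x ≢ y → Injective _≡_ _≡_ (pair x y)
pair-injective x≢y {zero}     {zero}     _  = refl
pair-injective x≢y {zero}     {suc zero} eq = contradiction eq x≢y
pair-injective x≢y {suc zero} {zero}     eq = contradiction (sym eq) x≢y
pair-injective x≢y {suc zero} {suc zero} _  = refl

pair-∈ : ∀ {N} {x y : Fin N} {S : Subset N} → x ∈ S → y ∈ S → ∀ i → pair x y i ∈ S
pair-∈ x∈S y∈S zero       = x∈S
pair-∈ x∈S y∈S (suc zero) = y∈S

unbit : Bool → Fin 2
unbit false = zero
unbit true  = suc zero

unbit-bit : ∀ i → unbit (bit i) ≡ i
unbit-bit zero       = refl
unbit-bit (suc zero) = refl

-- The diagonal value is never consulted.
colour : ∀ {R} → ([ R ]⁽ 2 ⁾ → Fin 2) → Fin R → Fin R → Bool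
colour χ d e with d Fin.≟ e
... | yes _   = false
... | no  d≢e = bit (χ (kset (pair d e) (pair-injective d≢e)))

colour-≡ : ∀ {R} (χ : [ R ]⁽ 2 ⁾ → Fin 2) {d e} (S : [ R ]⁽ 2 ⁾) →
  d ∈ proj₁ S → e ∈ proj₁ S → d ≢ e → colour χ d e ≡ bit (χ S)
colour-≡ χ {d} {e} S d∈S e∈S d≢e with d Fin.≟ e
... | yes d≡e  = contradiction d≡e d≢e
... | no  d≢e′ = cong (bit ∘ χ) (kset-unique (pair-injective d≢e′) S (pair-∈ d∈S e∈S))

-- The elements of a 2-set in `range γ` are compared through their indices, so the lemma serves the
-- increasing depths of a right comb and the decreasing ones of a left comb.
injective⇒monochromatic : ∀ {R m} (χ : [ R ]⁽ 2 ⁾ → Fin 2) {γ : Fin m → Fin R} (b : Bool) →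
  Injective _≡_ _≡_ γ →
  (∀ i j → i <ᶠ j → (S : [ R ]⁽ 2 ⁾) → γ i ∈ proj₁ S → γ j ∈ proj₁ S → bit (χ S) ≡ b) →
  Σ[ Y ∈ Subset R ] ∣ Y ∣ ≡ m × Monochromatic χ Y
injective⇒monochromatic χ {γ} b γ-inj γ-colour = range γ , ∣range∣ γ-inj , unbit b , mono
  where
  bit-mono : ∀ S → proj₁ S ⊆ range γ → bit (χ S) ≡ b
  bit-mono S S⊆Y
    with i , γi≡ ← ∈-range⁻ γ (S⊆Y (elems-∈ S zero))
       | j , γj≡ ← ∈-range⁻ γ (S⊆Y (elems-∈ S (suc zero)))
    with Fin.<-cmp i j
  ... | tri< i<j _ _ = γ-colour i j i<j S (subst (_∈ proj₁ S) (sym γi≡) (elems-∈ S zero))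
                                          (subst (_∈ proj₁ S) (sym γj≡) (elems-∈ S (suc zero)))
  ... | tri≈ _ refl _ with () ← elems-injective S (trans (sym γi≡) γj≡)
  ... | tri> _ _ j<i = γ-colour j i j<i S (subst (_∈ proj₁ S) (sym γj≡) (elems-∈ S (suc zero)))
                                          (subst (_∈ proj₁ S) (sym γi≡) (elems-∈ S zero))
  mono : ∀ S → proj₁ S ⊆ range γ → χ S ≡ unbit b
  mono S S⊆Y = trans (sym (unbit-bit (χ S))) (cong unbit (bit-mono S S⊆Y))

-- The ordering of pairs that encodes a colouring

mask : ∀ {M} → Vec Bool M → Vec Bool M → Vec Bool M
mask = zipWith _xor_

-- Flipping the same bits in both strings leaves the first difference in place; the entry of `w` at
-- that level decides whether the order is kept or, as in `mask-true`, reversed.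
mask-false : ∀ {M e} (w : Vec Bool M) {u v} → lookup w e ≡ false → Split e u v →
  Split e (mask w u) (mask w v)
mask-false (false ∷ w) refl fork     = fork
mask-false (b     ∷ w) w≡b  (skip s) = skip (mask-false w w≡b s)

mask-true : ∀ {M e} (w : Vec Bool M) {u v} → lookup w e ≡ true → Split e u v →
  Split e (mask w v) (mask w u)
mask-true (true ∷ w) refl fork     = fork
mask-true (b    ∷ w) w≡b  (skip s) = skip (mask-true w w≡b s)

-- Depth first, then the two masked endpoints: sides of a triple with equal depth and one common
-- endpoint are decided by the other endpoint.
PairKey : ℕ → Set
PairKey R = Fin R × Vec Bool R × Vec Bool R

infix 4 _≈ₚ_ _<ₚ_

_≈ₚ_ _<ₚ_ : ∀ {R} → Rel (PairKey R) 0ℓ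
_≈ₚ_ = Pointwise _≡_ (Pointwise _≡_ _≡_)
_<ₚ_ = ×-Lex _≡_ _<ᶠ_ (×-Lex _≡_ _<ₗ_ _<ₗ_)

<ₚ-isStrictTotalOrder : ∀ {R} → IsStrictTotalOrder (_≈ₚ_ {R}) _<ₚ_
<ₚ-isStrictTotalOrder = ×-isStrictTotalOrder Fin.<-isStrictTotalOrder
  (×-isStrictTotalOrder <ₗ-isStrictTotalOrder <ₗ-isStrictTotalOrder)

-- Among pairs splitting at depth d, coordinates are compared after exchanging the two
-- branches at every level e for which {d , e} has colour true.
maskedKey : ∀ {R} → ([ R ]⁽ 2 ⁾ → Fin 2) → Fin R → (x y : Fin (2 ^ R)) → PairKey R
maskedKey {R} χ d x y = d , mask w (bits R x) , mask w (bits R y)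
  where w = tabulate (colour χ d)

pairKey : ∀ {R} → ([ R ]⁽ 2 ⁾ → Fin 2) → [ 2 ^ R ]⁽ 2 ⁾ → PairKey R
pairKey {R} χ S = maskedKey χ (proj₁ (splitting R x y x<y)) x y
  where
  x = elems S zero
  y = elems S (suc zero)
  x<y = elems-increasing S zero (suc zero) (s≤s z≤n)

-- Endpoints and depth are unique, so any known listing and split can replace those chosen by
-- `pairKey`.
pairKey-≡ : ∀ {R} (χ : [ R ]⁽ 2 ⁾ → Fin 2) (S : [ 2 ^ R ]⁽ 2 ⁾) {d x y} →
  x ∈ proj₁ S → y ∈ proj₁ S → x <ᶠ y → Splits d x y → pairKey χ S ≡ maskedKey χ d x y
pairKey-≡ {R} χ S {d} {x} {y} x∈S y∈S x<y s =
  trans (cong (λ d → maskedKey χ d (elems S zero) (elems S (suc zero))) d′≡d)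
        (cong₂ (maskedKey χ d) x′≡x y′≡y)
  where
  x′≡x = elems-unique S (pair-increasing x<y) (pair-∈ x∈S y∈S) zero
  y′≡y = elems-unique S (pair-increasing x<y) (pair-∈ x∈S y∈S) (suc zero)
  s′ = splitting R (elems S zero) (elems S (suc zero)) (elems-increasing S zero (suc zero) (s≤s z≤n))
  d′≡d = Split-unique (subst₂ (Splits (proj₁ s′)) x′≡x y′≡y (proj₂ s′)) s

bool-≡ : ∀ {a b} → ¬ (a ≡ false × b ≡ true) → ¬ (a ≡ true × b ≡ false) → a ≡ b
bool-≡ {false} {false} _  _  = refl
bool-≡ {false} {true}  ¬p _  = contradiction (refl , refl) ¬p
bool-≡ {true}  {false} _  ¬q = contradiction (refl , refl) ¬q
bool-≡ {true}  {true}  _  _  = refl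

-- Triples and their sides

triple : ∀ {N} → Fin N → Fin N → Fin N → Vector (Fin N) 3
triple x y z = x ◂ y ◂ z ◂ ⟨⟩

triple-increasing : ∀ {N} {x y z : Fin N} → x <ᶠ y → y <ᶠ z → Increasing (triple x y z)
triple-increasing {x = x} {y} {z} x<y y<z =
  ◂-increasing {h = pair y z} (λ where zero → x<y ; (suc zero) → Fin.<-trans {i = x} {y} {z} x<y y<z)
                              (pair-increasing y<z)

data Side : Set where
  ₀₁ ₀₂ ₁₂ : Side

lo hi : Side → Fin 3
lo ₀₁ = zero
lo ₀₂ = zero
lo ₁₂ = suc zero
hi ₀₁ = suc zero
hi ₀₂ = suc (suc zero)
hi ₁₂ = suc (suc zero)

lo<hi : ∀ s → lo s <ᶠ hi s
lo<hi ₀₁ = s≤s z≤n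
lo<hi ₀₂ = s≤s z≤n
lo<hi ₁₂ = s≤s (s≤s z≤n)

ends : Side → Vector (Fin 3) 2
ends s = pair (lo s) (hi s)

canonical-pairs⇒monochromatic : ∀ {R} m (χ : [ R ]⁽ 2 ⁾ → Fin 2) {X : Subset (2 ^ R)} →
  ∣ X ∣ ≡ 3 + m → Canonical (KeyOrder _≈ₚ_ _<ₚ_ (pairKey χ)) X →
  Σ[ Y ∈ Subset R ] ∣ Y ∣ ≡ 2 + m × Monochromatic χ Y
canonical-pairs⇒monochromatic {R} m χ {X} ∣X∣≡3+m canonical = result
  where
  e : Fin (3 + m) → Fin (2 ^ R)
  e = elems (X , ∣X∣≡3+m)
  e-inc : Increasing e
  e-inc = elems-increasing (X , ∣X∣≡3+m)

  infix 4 _⊏_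
  _⊏_ : Rel [ 2 ^ R ]⁽ 2 ⁾ 0ℓ
  _⊏_ = KeyOrder _≈ₚ_ _<ₚ_ (pairKey χ)
  open IsStrictTotalOrder (KeyOrder-isStrictTotalOrder <ₚ-isStrictTotalOrder (pairKey χ))
    using () renaming (asym to ⊏-asym)

  -- The depths are inferred from the split witnesses, so for triples taken from a comb they are
  -- literally values of `γ`.
  record Triple : Set where
    constructor tr
    field
      i j l   : Fin (3 + m)
      i<j     : i <ᶠ j
      j<l     : j <ᶠ l
      {c d}   : Fin R
      split₀₁ : Splits c (e i) (e j)
      split₁₂ : Splits d (e j) (e l)
    t : Fin 3 → Fin (2 ^ R)
    t = e ∘ triple i j l
    t-inc : Increasing t
    t-inc a b a<b = e-inc _ _ (triple-increasing i<j j<l a b a<b)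

  open Triple

  edge : Triple → Side → [ 2 ^ R ]⁽ 2 ⁾
  edge τ s = kset (t τ ∘ ends s) (pair-injective (Fin.<⇒≢ (lo<hi s)) ∘ increasing⇒injective (t-inc τ))

  -- Sending `τ` to `σ` in order carries sides to corresponding sides, so all triples compare their
  -- sides alike.
  edge-transfer : ∀ (τ σ : Triple) s s′ → edge τ s ⊏ edge τ s′ → edge σ s ⊏ edge σ s′
  edge-transfer τ σ s s′ = transfer {_≺_ = _⊏_} canonical
    {t τ} {t σ} (λ q → elems-∈ (X , ∣X∣≡3+m) (triple (i τ) (j τ) (l τ) q))
    (λ q → elems-∈ (X , ∣X∣≡3+m) (triple (i σ) (j σ) (l σ) q))
    (increasing⇒injective (t-inc τ))
    (λ p q lt → t-inc σ p q (increasing-reflects-< (t-inc τ) p q lt))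
    (pair-injective (Fin.<⇒≢ (lo<hi s))) (pair-injective (Fin.<⇒≢ (lo<hi s′)))
    {edge τ s} {edge τ s′} {edge σ s} {edge σ s′}
    (∈-range⁺ (t τ ∘ ends s)) (∈-range⁺ (t σ ∘ ends s))
    (∈-range⁺ (t τ ∘ ends s′)) (∈-range⁺ (t σ ∘ ends s′))

  edgeKey : Triple → Side → Fin R → PairKey R
  edgeKey τ s f = maskedKey χ f (t τ (lo s)) (t τ (hi s))

  EdgeSplits : Triple → Side → Fin R → Set
  EdgeSplits τ s f = Splits f (t τ (lo s)) (t τ (hi s))

  edge-key : ∀ (τ : Triple) s {f} → EdgeSplits τ s f → pairKey χ (edge τ s) ≡ edgeKey τ s f
  edge-key τ s = pairKey-≡ χ (edge τ s)
    (∈-range⁺ (t τ ∘ ends s) zero) (∈-range⁺ (t τ ∘ ends s) (suc zero)) (t-inc τ (lo s) (hi s) (lo<hi s))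

  edge-⊏ : ∀ (τ : Triple) s s′ {f f′} → EdgeSplits τ s f → EdgeSplits τ s′ f′ →
    edgeKey τ s f <ₚ edgeKey τ s′ f′ → edge τ s ⊏ edge τ s′
  edge-⊏ τ s s′ sp sp′ lt = inj₁ (subst₂ _<ₚ_ (sym (edge-key τ s sp)) (sym (edge-key τ s′ sp′)) lt)

  row : Fin R → Vec Bool R
  row d = tabulate (colour χ d)
  row-≡ : ∀ d e {b} → colour χ d e ≡ b → lookup (row d) e ≡ b
  row-≡ d e = trans (lookup∘tabulate (colour χ d) e)

  -- Depth is the leading component of the key, so comparing the two short sides reveals the
  -- direction of the triple.
  right-₀₁ : ∀ τ → c τ <ᶠ d τ → edge τ ₀₁ ⊏ edge τ ₁₂
  right-₀₁ τ c<d = edge-⊏ τ ₀₁ ₁₂ (split₀₁ τ) (split₁₂ τ) (inj₁ c<d)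

  left-₁₂ : ∀ τ → d τ <ᶠ c τ → edge τ ₁₂ ⊏ edge τ ₀₁
  left-₁₂ τ d<c = edge-⊏ τ ₁₂ ₀₁ (split₁₂ τ) (split₀₁ τ) (inj₁ d<c)

  right-split₀₂ : ∀ τ → c τ <ᶠ d τ → EdgeSplits τ ₀₂ (c τ)
  right-split₀₂ τ = Split-trans-< (split₀₁ τ) (split₁₂ τ)

  left-split₀₂ : ∀ τ → d τ <ᶠ c τ → EdgeSplits τ ₀₂ (d τ)
  left-split₀₂ τ = Split-trans-> (split₀₁ τ) (split₁₂ τ)

  -- For `c < d` the sides `₀₁` and `₀₂` both split at `c` and share the lower endpoint. Their upper
  -- endpoints split at `d`, and row `c` of the colouring decides whether the mask reverses them.
  right-false : ∀ τ → c τ <ᶠ d τ → colour χ (c τ) (d τ) ≡ false → edge τ ₀₁ ⊏ edge τ ₀₂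
  right-false τ c<d col = edge-⊏ τ ₀₁ ₀₂ (split₀₁ τ) (right-split₀₂ τ c<d)
    (inj₂ (refl , inj₂ (refl , d τ , mask-false (row (c τ)) (row-≡ (c τ) (d τ) col) (split₁₂ τ))))

  right-true : ∀ τ → c τ <ᶠ d τ → colour χ (c τ) (d τ) ≡ true → edge τ ₀₂ ⊏ edge τ ₀₁
  right-true τ c<d col = edge-⊏ τ ₀₂ ₀₁ (right-split₀₂ τ c<d) (split₀₁ τ)
    (inj₂ (refl , inj₂ (refl , d τ , mask-true (row (c τ)) (row-≡ (c τ) (d τ) col) (split₁₂ τ))))

  -- For `d < c` the sides `₀₂` and `₁₂` both split at `d` and share the upper endpoint; the lower
  -- endpoints split at `c` and are masked by row `d`.
  left-false : ∀ τ → d τ <ᶠ c τ → colour χ (d τ) (c τ) ≡ false → edge τ ₀₂ ⊏ edge τ ₁₂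
  left-false τ d<c col = edge-⊏ τ ₀₂ ₁₂ (left-split₀₂ τ d<c) (split₁₂ τ)
    (inj₂ (refl , inj₁ (c τ , mask-false (row (d τ)) (row-≡ (d τ) (c τ) col) (split₀₁ τ))))

  left-true : ∀ τ → d τ <ᶠ c τ → colour χ (d τ) (c τ) ≡ true → edge τ ₁₂ ⊏ edge τ ₀₂
  left-true τ d<c col = edge-⊏ τ ₁₂ ₀₂ (split₁₂ τ) (left-split₀₂ τ d<c)
    (inj₂ (refl , inj₁ (c τ , mask-true (row (d τ)) (row-≡ (d τ) (c τ) col) (split₀₁ τ))))

  right-all : ∀ τ σ → c τ <ᶠ d τ → c σ <ᶠ d σ
  right-all τ σ c<d with Fin.<-cmp (c σ) (d σ)
  ... | tri< lt _ _ = lt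
  ... | tri≈ _ eq _ = contradiction eq (Split-≢ (split₀₁ σ) (split₁₂ σ))
  ... | tri> _ _ gt = contradiction (edge-transfer τ σ ₀₁ ₁₂ (right-₀₁ τ c<d))
    (⊏-asym {edge σ ₁₂} {edge σ ₀₁} (left-₁₂ σ gt))

  left-all : ∀ τ σ → d τ <ᶠ c τ → d σ <ᶠ c σ
  left-all τ σ d<c with Fin.<-cmp (c σ) (d σ)
  ... | tri< lt _ _ = contradiction (edge-transfer τ σ ₁₂ ₀₁ (left-₁₂ τ d<c))
    (⊏-asym {edge σ ₀₁} {edge σ ₁₂} (right-₀₁ σ lt))
  ... | tri≈ _ eq _ = contradiction eq (Split-≢ (split₀₁ σ) (split₁₂ σ))
  ... | tri> _ _ gt = gt

  -- Different colours would order the sides `₀₁` and `₀₂` oppositely in two triples.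
  right-colour : ∀ τ σ → c τ <ᶠ d τ → colour χ (c σ) (d σ) ≡ colour χ (c τ) (d τ)
  right-colour τ σ c<d = bool-≡
    (λ (σf , τt) → ⊏-asym {edge τ ₀₂} {edge τ ₀₁} (right-true τ c<d τt)
      (edge-transfer σ τ ₀₁ ₀₂ (right-false σ (right-all τ σ c<d) σf)))
    (λ (σt , τf) → ⊏-asym {edge τ ₀₁} {edge τ ₀₂} (right-false τ c<d τf)
      (edge-transfer σ τ ₀₂ ₀₁ (right-true σ (right-all τ σ c<d) σt)))

  left-colour : ∀ τ σ → d τ <ᶠ c τ → colour χ (d σ) (c σ) ≡ colour χ (d τ) (c τ)
  left-colour τ σ d<c = bool-≡
    (λ (σf , τt) → ⊏-asym {edge τ ₁₂} {edge τ ₀₂} (left-true τ d<c τt)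
      (edge-transfer σ τ ₀₂ ₁₂ (left-false σ (left-all τ σ d<c) σf)))
    (λ (σt , τf) → ⊏-asym {edge τ ₀₂} {edge τ ₁₂} (left-false τ d<c τf)
      (edge-transfer σ τ ₁₂ ₀₂ (left-true σ (left-all τ σ d<c) σt)))

  τ : Triple
  τ = tr zero (suc zero) (suc (suc zero)) (s≤s z≤n) (s≤s (s≤s z≤n))
    (proj₂ (splitting R _ _ (e-inc zero (suc zero) (s≤s z≤n))))
    (proj₂ (splitting R _ _ (e-inc (suc zero) (suc (suc zero)) (s≤s (s≤s z≤n)))))

  result : Σ[ Y ∈ Subset R ] ∣ Y ∣ ≡ 2 + m × Monochromatic χ Y
  result with Fin.<-cmp (c τ) (d τ)
  -- The vertices `i < j <` last form a triple with depths `γ i` and `γ j`, so every pair of depths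
  -- of the comb gets the colour of the reference triple `τ`.
  ... | tri< c<d _ _ = injective⇒monochromatic χ (colour χ (c τ) (d τ)) (increasing⇒injective γ-inc)
      λ i j i<j S γi∈S γj∈S → trans (sym (colour-≡ χ S γi∈S γj∈S (Fin.<⇒≢ (γ-inc i j i<j))))
        (right-colour τ (tr _ _ _ (inject₁-< i j i<j) (inject₁<fromℕ j) (γ-split i j i<j) (γ-last j)) c<d)
    where
    open RightComb (rightComb e-inc λ i j l i<j j<l s₀₁ s₁₂ → right-all τ (tr i j l i<j j<l s₀₁ s₁₂) c<d)
  ... | tri≈ _ c≡d _ = contradiction c≡d (Split-≢ (split₀₁ τ) (split₁₂ τ))
  -- Here the triple consists of the first vertex and the vertices `suc i`, `suc j`; its depths are
  -- again `γ i` and `γ j`.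
  ... | tri> _ _ d<c = injective⇒monochromatic χ (colour χ (d τ) (c τ)) γ-injective
      λ i j i<j S γi∈S γj∈S → trans (sym (colour-≡ χ S γj∈S γi∈S (Fin.<⇒≢ (γ-dec i j i<j))))
        (left-colour τ (tr zero (suc i) (suc j) (s≤s z≤n) (s≤s i<j) (γ-first i) (γ-split i j i<j)) d<c)
    where
    open LeftComb (leftComb e-inc λ i j l i<j j<l s₀₁ s₁₂ → left-all τ (tr i j l i<j j<l s₀₁ s₁₂) d<c)

-- Stepping up from (k ∸ 1)-sets to k-sets

-- Concatenating the listings of two separated k-sets gives an increasing sequence of length 2k, and
-- any two such sequences correspond in order.
transfer-separated : ∀ {N k} {_≺_ : Rel [ N ]⁽ k ⁾ 0ℓ} {X} → Canonical _≺_ X →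
  (S S′ T T′ : [ N ]⁽ k ⁾) →
  proj₁ S ⊆ X → proj₁ S′ ⊆ X → proj₁ T ⊆ X → proj₁ T′ ⊆ X →
  (∀ {x y} → x ∈ proj₁ S → y ∈ proj₁ S′ → x <ᶠ y) →
  (∀ {x y} → x ∈ proj₁ T → y ∈ proj₁ T′ → x <ᶠ y) →
  S ≺ S′ → T ≺ T′
transfer-separated {N} {k} {_≺_} {X} canonical S S′ T T′ S⊆X S′⊆X T⊆X T′⊆X S<S′ T<T′ =
  transfer {_≺_ = _≺_} canonical {elems S ⧺ elems S′} {elems T ⧺ elems T′}
    (⧺-∈X S S′ S⊆X S′⊆X) (⧺-∈X T T′ T⊆X T′⊆X) (increasing⇒injective S⧺S′-inc)
    (λ i j lt → ⧺-inc T T′ T<T′ i j (increasing-reflects-< S⧺S′-inc i j lt))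
    {_↑ˡ k} {k ↑ʳ_} (Fin.↑ˡ-injective k _ _) (Fin.↑ʳ-injective k _ _)
    {S} {S′} {T} {T′} (left S S′) (left T T′) (right S S′) (right T T′)
  where
  ⧺-∈X : ∀ (U V : [ N ]⁽ k ⁾) → proj₁ U ⊆ X → proj₁ V ⊆ X → ∀ i → (elems U ⧺ elems V) i ∈ X
  ⧺-∈X U V U⊆X V⊆X i with splitAt k i
  ... | inj₁ j = U⊆X (elems-∈ U j)
  ... | inj₂ j = V⊆X (elems-∈ V j)
  left : ∀ (U V : [ N ]⁽ k ⁾) t → (elems U ⧺ elems V) (t ↑ˡ k) ∈ proj₁ U
  left U V t = subst (_∈ proj₁ U) (sym (lookup-++ˡ (elems U) (elems V) t)) (elems-∈ U t)
  right : ∀ (U V : [ N ]⁽ k ⁾) t → (elems U ⧺ elems V) (k ↑ʳ t) ∈ proj₁ V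
  right U V t = subst (_∈ proj₁ V) (sym (lookup-++ʳ (elems U) (elems V) t)) (elems-∈ V t)
  ⧺-inc : ∀ (U V : [ N ]⁽ k ⁾) → (∀ {x y} → x ∈ proj₁ U → y ∈ proj₁ V → x <ᶠ y) →
    Increasing (elems U ⧺ elems V)
  ⧺-inc U V U<V i j i<j with splitAt k i | Fin.join-splitAt k k i | splitAt k j | Fin.join-splitAt k k j
  ... | inj₁ s | refl | inj₁ t | refl =
    elems-increasing U s t (subst₂ _<_ (Fin.toℕ-↑ˡ s k) (Fin.toℕ-↑ˡ t k) i<j)
  ... | inj₁ s | refl | inj₂ t | refl = U<V (elems-∈ U s) (elems-∈ V t)
  ... | inj₂ s | refl | inj₁ t | refl = contradiction i<j (ℕ.<-asym
    (subst₂ _<_ (sym (Fin.toℕ-↑ˡ t k)) (sym (Fin.toℕ-↑ʳ k s)) (ℕ.<-≤-trans (Fin.toℕ<n t) (ℕ.m≤m+n k (toℕ s)))))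
  ... | inj₂ s | refl | inj₂ t | refl =
    elems-increasing V s t (ℕ.+-cancelˡ-< k _ _ (subst₂ _<_ (Fin.toℕ-↑ʳ k s) (Fin.toℕ-↑ʳ k t) i<j))
  S⧺S′-inc : Increasing (elems S ⧺ elems S′)
  S⧺S′-inc = ⧺-inc S S′ S<S′

-- Unoriented splits treat both combs at once: the apex lies above the other vertices in a right
-- comb and below them in a left comb.
Diff : ∀ {M} → Fin M → Rel (Fin (2 ^ M)) 0ℓ
Diff d x y = Splits d x y ⊎ Splits d y x

Diff-unique : ∀ {M} {d e : Fin M} {x y} → Splits d x y → Diff e x y → d ≡ e
Diff-unique s (inj₁ s′) = Split-unique s s′
Diff-unique s (inj₂ s′) = contradiction s′ (Split-asym s)

Diff-irrefl : ∀ {M} {d : Fin M} {x} → ¬ Diff d x x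
Diff-irrefl (inj₁ s) = Split-irrefl s
Diff-irrefl (inj₂ s) = Split-irrefl s

-- Depth sets and the keys of k-sets

HasDepth : ∀ {M} → Subset (2 ^ M) → Fin M → Set
HasDepth S d = ∃[ x ] (x ∈ S × ∃[ y ] (y ∈ S × Splits d x y))

hasDepth? : ∀ {M} (S : Subset (2 ^ M)) → Decidable (HasDepth {M} S)
hasDepth? {M} S d =
  Fin.any? λ x → x ∈? S ×-dec Fin.any? λ y → y ∈? S ×-dec split? d (bits M x) (bits M y)

depthSet : ∀ {M} → Subset (2 ^ M) → Subset M
depthSet S = comprehension (hasDepth? S)

-- A depth set of the wrong size cannot be compared by the given ordering; it is sent to an added
-- bottom element.
sized : ∀ {N} k → Subset N → [ N ]⁽ k ⁾ ₋
sized k S with ∣ S ∣ ℕ.≟ k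
... | yes ∣S∣≡k = [ S , ∣S∣≡k ]
... | no  _     = ⊥₋

sized-≡ : ∀ {N k} (S : [ N ]⁽ k ⁾) → sized k (proj₁ S) ≡ [ S ]
sized-≡ {k = k} (S , ∣S∣≡k) with ∣ S ∣ ℕ.≟ k
... | yes _     = cong [_] (kset-≡ refl)
... | no  ∣S∣≢k = contradiction ∣S∣≡k ∣S∣≢k

-- Only the first three elements are tested, so that a constant value on all k-sets
-- decides every triple with at least k − 3 elements above it.
goesRight : ∀ {M k} → [ 2 ^ M ]⁽ 3 + k ⁾ → Bool
goesRight {M} S = does (d₀₁ Fin.<? d₁₂)
  where
  x : Fin _ → Fin (2 ^ M)
  x = elems S
  d₀₁ = proj₁ (splitting M (x zero) (x (suc zero)) (elems-increasing S zero (suc zero) (s≤s z≤n)))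
  d₁₂ = proj₁ (splitting M (x (suc zero)) (x (suc (suc zero)))
    (elems-increasing S (suc zero) (suc (suc zero)) (s≤s (s≤s z≤n))))

goesRight-≡ : ∀ {M k} (S : [ 2 ^ M ]⁽ 3 + k ⁾) {h} → Increasing h → (∀ i → h i ∈ proj₁ S) → ∀ {c d} →
  Splits c (h zero) (h (suc zero)) → Splits d (h (suc zero)) (h (suc (suc zero))) →
  goesRight {M} S ≡ does (c Fin.<? d)
goesRight-≡ {M} S {h} h-inc h∈S s₀₁ s₁₂ = cong₂ (λ c d → does (c Fin.<? d))
  (same zero (suc zero) (s≤s z≤n) s₀₁) (same (suc zero) (suc (suc zero)) (s≤s (s≤s z≤n)) s₁₂)
  where
  x≡h = elems-unique S h-inc h∈S
  same : ∀ i j i<j {c} → Splits c (h i) (h j) →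
    proj₁ (splitting M (elems S i) (elems S j) (elems-increasing S i j i<j)) ≡ c
  same i j i<j s with splitting M (elems S i) (elems S j) (elems-increasing S i j i<j)
  ... | c′ , s′ = Split-unique (subst₂ (Splits c′) (x≡h i) (x≡h j) s′) s

SetKey : ℕ → ℕ → Set
SetKey M k = Bool × [ M ]⁽ k ⁾ ₋

_≈ₛ_ : ∀ {M k} → Rel (SetKey M k) 0ℓ
_≈ₛ_ = Pointwise _≡_ _≡_

setLess : ∀ {M k} → Rel [ M ]⁽ k ⁾ 0ℓ → Rel (SetKey M k) 0ℓ
setLess _≺_ = ×-Lex _≡_ Bool._<_ (Infimum._<₋_ _≺_)

setLess-isStrictTotalOrder : ∀ {M k} {_≺_ : Rel [ M ]⁽ k ⁾ 0ℓ} → IsStrictTotalOrder _≡_ _≺_ →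
  IsStrictTotalOrder _≈ₛ_ (setLess _≺_)
setLess-isStrictTotalOrder {_≺_ = _≺_} sto =
  ×-isStrictTotalOrder Bool.<-isStrictTotalOrder (Infimum.<₋-isStrictTotalOrder-≡ _≺_ sto)

-- The uniformity k ≥ 3 of the theorem is written `3 + k` from here on, so `k` counts the elements
-- after the first three and depth sets of interest have size `2 + k`.
setKey : ∀ {M k} → [ 2 ^ M ]⁽ 3 + k ⁾ → SetKey M (2 + k)
setKey {M} {k} S = goesRight {M} S , sized (2 + k) (depthSet {M} (proj₁ S))

StepUp : ∀ {M k} → Rel [ M ]⁽ 2 + k ⁾ 0ℓ → Rel [ 2 ^ M ]⁽ 3 + k ⁾ 0ℓ
StepUp {M} _≺_ = KeyOrder _≈ₛ_ (setLess _≺_) (setKey {M})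

StepUp-isStrictTotalOrder : ∀ {M k} {_≺_ : Rel [ M ]⁽ 2 + k ⁾ 0ℓ} → IsStrictTotalOrder _≡_ _≺_ →
  IsStrictTotalOrder _≡_ (StepUp {M} _≺_)
StepUp-isStrictTotalOrder {M} sto = KeyOrder-isStrictTotalOrder (setLess-isStrictTotalOrder sto) (setKey {M})

-- A set Y of depths represented by vertices of Z: a set of depths S ⊆ Y is
-- recovered as the depth set of {apex} ∪ g[S].
record DepthSection {M} (Z : Subset (2 ^ M)) (n : ℕ) : Set where
  field
    Y         : Subset M
    ∣Y∣≡n     : ∣ Y ∣ ≡ n
    apex      : Fin (2 ^ M)
    apex∈Z    : apex ∈ Z
    g         : Fin M → Fin (2 ^ M)
    g∈Z       : ∀ {d} → d ∈ Y → g d ∈ Z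
    apex-diff : ∀ {d} → d ∈ Y → Diff d (g d) apex
    g-diff    : ∀ d e → d ∈ Y → e ∈ Y → d <ᶠ e → Diff d (g d) (g e)
    -- The first alternative comes from right combs, the second from left combs, where deeper
    -- branches lie nearer to the apex.
    order     : (∀ {d} → d ∈ Y → g d <ᶠ apex) × (∀ d e → d ∈ Y → e ∈ Y → d <ᶠ e → g d <ᶠ g e)
              ⊎ (∀ {d} → d ∈ Y → apex <ᶠ g d) × (∀ d e → d ∈ Y → e ∈ Y → d <ᶠ e → g e <ᶠ g d)

  apex≢g : ∀ {d} → d ∈ Y → apex ≢ g d
  apex≢g {d} d∈Y eq = Diff-irrefl {M} (subst (Diff d (g d)) eq (apex-diff d∈Y))

  g-injective : ∀ {d e} → d ∈ Y → e ∈ Y → g d ≡ g e → d ≡ e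
  g-injective {d} {e} d∈Y e∈Y eq with Fin.<-cmp d e
  ... | tri< d<e _ _ = contradiction (subst (Diff d (g d)) (sym eq) (g-diff d e d∈Y e∈Y d<e)) (Diff-irrefl {M})
  ... | tri≈ _ d≡e _ = d≡e
  ... | tri> _ _ e<d = contradiction (subst (Diff e (g e)) eq (g-diff e d e∈Y d∈Y e<d)) (Diff-irrefl {M})

  apex◂ : ∀ {m} → (Fin m → Fin M) → Vector (Fin (2 ^ M)) (suc m)
  apex◂ h = apex ◂ (g ∘ h)

  apex◂-injective : ∀ {m} {h : Fin m → Fin M} → (∀ i → h i ∈ Y) → Injective _≡_ _≡_ h →
    Injective _≡_ _≡_ (apex◂ h)
  apex◂-injective h∈Y h-inj {zero}  {zero}  _  = refl
  apex◂-injective h∈Y h-inj {zero}  {suc j} eq = contradiction eq (apex≢g (h∈Y j))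
  apex◂-injective h∈Y h-inj {suc i} {zero}  eq = contradiction (sym eq) (apex≢g (h∈Y i))
  apex◂-injective h∈Y h-inj {suc i} {suc j} eq = cong suc (h-inj (g-injective (h∈Y i) (h∈Y j) eq))

  -- `order` fixes the position of the apex and whether `g` keeps or reverses the order, uniformly
  -- in the set of depths; hence `h` and `h′` yield the same pattern of vertices.
  apex◂-monotone : ∀ {m} {h h′ : Fin m → Fin M} → (∀ i → h i ∈ Y) → (∀ i → h′ i ∈ Y) →
    Increasing h → Increasing h′ → ∀ i j → apex◂ h i <ᶠ apex◂ h j → apex◂ h′ i <ᶠ apex◂ h′ j
  apex◂-monotone h∈Y h′∈Y h-inc h′-inc zero zero lt = contradiction lt (Fin.<-irrefl {x = apex} refl)
  apex◂-monotone {h = h} h∈Y h′∈Y h-inc h′-inc zero (suc j) lt with order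
  ... | inj₁ (g<apex , _) = contradiction (g<apex (h∈Y j)) (Fin.<-asym {x = apex} {g (h j)} lt)
  ... | inj₂ (apex<g , _) = apex<g (h′∈Y j)
  apex◂-monotone {h = h} h∈Y h′∈Y h-inc h′-inc (suc i) zero lt with order
  ... | inj₁ (g<apex , _) = g<apex (h′∈Y i)
  ... | inj₂ (apex<g , _) = contradiction (apex<g (h∈Y i)) (Fin.<-asym {x = g (h i)} {apex} lt)
  apex◂-monotone {h = h} h∈Y h′∈Y h-inc h′-inc (suc i) (suc j) lt with order | Fin.<-cmp i j
  ... | _ | tri≈ _ refl _ = contradiction lt (Fin.<-irrefl {x = g (h i)} refl)
  ... | inj₁ (_ , g-inc) | tri< i<j _ _ = g-inc _ _ (h′∈Y i) (h′∈Y j) (h′-inc i j i<j)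
  ... | inj₁ (_ , g-inc) | tri> _ _ j<i =
    contradiction (g-inc _ _ (h∈Y j) (h∈Y i) (h-inc j i j<i)) (Fin.<-asym {x = g (h i)} {g (h j)} lt)
  ... | inj₂ (_ , g-dec) | tri< i<j _ _ =
    contradiction (g-dec _ _ (h∈Y i) (h∈Y j) (h-inc i j i<j)) (Fin.<-asym {x = g (h i)} {g (h j)} lt)
  ... | inj₂ (_ , g-dec) | tri> _ _ j<i = g-dec _ _ (h′∈Y j) (h′∈Y i) (h′-inc j i j<i)

  apex◂-∈Z : ∀ {m} {h : Fin m → Fin M} → (∀ i → h i ∈ Y) → ∀ i → apex◂ h i ∈ Z
  apex◂-∈Z h∈Y zero    = apex∈Z
  apex◂-∈Z h∈Y (suc i) = g∈Z (h∈Y i)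

  lift : ∀ {k} (S : [ M ]⁽ k ⁾) → proj₁ S ⊆ Y → [ 2 ^ M ]⁽ suc k ⁾
  lift S S⊆Y = kset (apex◂ (elems S)) (apex◂-injective (S⊆Y ∘ elems-∈ S) (elems-injective S))

  lift-⊆ : ∀ {k} (S : [ M ]⁽ k ⁾) (S⊆Y : proj₁ S ⊆ Y) → proj₁ (lift S S⊆Y) ⊆ Z
  lift-⊆ S S⊆Y = range-⊆ {h = apex◂ (elems S)} (apex◂-∈Z (S⊆Y ∘ elems-∈ S))

  apex∈lift : ∀ {k} (S : [ M ]⁽ k ⁾) (S⊆Y : proj₁ S ⊆ Y) → apex ∈ proj₁ (lift S S⊆Y)
  apex∈lift S S⊆Y = ∈-range⁺ (apex◂ (elems S)) zero

  g∈lift : ∀ {k} (S : [ M ]⁽ k ⁾) (S⊆Y : proj₁ S ⊆ Y) {d} → d ∈ proj₁ S → g d ∈ proj₁ (lift S S⊆Y)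
  g∈lift S S⊆Y d∈S with i , refl ← elems-surjective S d∈S = ∈-range⁺ (apex◂ (elems S)) (suc i)

  -- The apex and `g d` differ at `d`, and two vertices `g d`, `g e` differ at the smaller of `d`
  -- and `e`. So no new depth arises, and each `d` in `S` is realised with the apex.
  depthSet-lift : ∀ {k} (S : [ M ]⁽ k ⁾) (S⊆Y : proj₁ S ⊆ Y) →
    depthSet {M} (proj₁ (lift S S⊆Y)) ≡ proj₁ S
  depthSet-lift S S⊆Y = ⊆-antisym ⊆S ⊇S
    where
    Ŝ = proj₁ (lift S S⊆Y)
    ∈Y : ∀ i → elems S i ∈ Y
    ∈Y i = S⊆Y (elems-∈ S i)
    depth : ∀ i j {d} → Splits d (apex◂ (elems S) i) (apex◂ (elems S) j) → d ∈ proj₁ S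
    depth zero zero s = contradiction s Split-irrefl
    depth zero (suc j) s with refl ← Diff-unique {M} s (swap (apex-diff (∈Y j))) = elems-∈ S j
    depth (suc i) zero s with refl ← Diff-unique {M} s (apex-diff (∈Y i)) = elems-∈ S i
    depth (suc i) (suc j) s with Fin.<-cmp i j
    ... | tri< i<j _ _
      with refl ← Diff-unique {M} s (g-diff _ _ (∈Y i) (∈Y j) (elems-increasing S i j i<j)) =
      elems-∈ S i
    ... | tri≈ _ refl _ = contradiction s Split-irrefl
    ... | tri> _ _ j<i
      with refl ← Diff-unique {M} s (swap (g-diff _ _ (∈Y j) (∈Y i) (elems-increasing S j i j<i))) =
      elems-∈ S j
    ⊆S : depthSet {M} Ŝ ⊆ proj₁ S
    ⊆S d∈ with x , x∈ , y , y∈ , s ← ∈-comprehension⁻ (hasDepth? {M} Ŝ) d∈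
      with i , refl ← ∈-range⁻ (apex◂ (elems S)) x∈ | j , refl ← ∈-range⁻ (apex◂ (elems S)) y∈ = depth i j s
    ⊇S : proj₁ S ⊆ depthSet {M} Ŝ
    ⊇S {d} d∈S with apex-diff (S⊆Y d∈S)
    ... | inj₁ s = ∈-comprehension⁺ (hasDepth? {M} Ŝ) (g d , g∈lift S S⊆Y d∈S , apex , apex∈lift S S⊆Y , s)
    ... | inj₂ s = ∈-comprehension⁺ (hasDepth? {M} Ŝ) (apex , apex∈lift S S⊆Y , g d , g∈lift S S⊆Y d∈S , s)

rightSection : ∀ {M m} {e : Fin (suc m) → Fin (2 ^ M)} → Increasing e → RightComb {M} e →
  DepthSection {M} (range e) m
rightSection {M} {m} {e} e-inc comb = record
  { Y         = range γ
  ; ∣Y∣≡n     = ∣range∣ γ-inj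
  ; apex      = e (fromℕ m)
  ; apex∈Z    = ∈-range⁺ e (fromℕ m)
  ; g         = g
  ; g∈Z       = g∈Z
  ; apex-diff = apex-diff
  ; g-diff    = g-diff
  ; order     = inj₁ (g<apex , g-inc)
  }
  where
  open RightComb comb
  γ-inj = increasing⇒injective γ-inc
  g : Fin M → Fin (2 ^ M)
  -- The apex is the default value; the fields constrain `g` only on `range γ`.
  g = extension γ (e ∘ inject₁) (e (fromℕ m))
  g-γ : ∀ i → g (γ i) ≡ e (inject₁ i)
  g-γ = extension-β γ-inj (e ∘ inject₁) (e (fromℕ m))
  g∈Z : ∀ {d} → d ∈ range γ → g d ∈ range e
  g∈Z d∈Y with i , refl ← ∈-range⁻ γ d∈Y = subst (_∈ range e) (sym (g-γ i)) (∈-range⁺ e (inject₁ i))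
  apex-diff : ∀ {d} → d ∈ range γ → Diff d (g d) (e (fromℕ m))
  apex-diff d∈Y with i , refl ← ∈-range⁻ γ d∈Y =
    subst (λ x → Diff (γ i) x (e (fromℕ m))) (sym (g-γ i)) (inj₁ (γ-last i))
  g-diff : ∀ d f → d ∈ range γ → f ∈ range γ → d <ᶠ f → Diff d (g d) (g f)
  g-diff d f d∈Y f∈Y d<f with i , refl ← ∈-range⁻ γ d∈Y | j , refl ← ∈-range⁻ γ f∈Y =
    subst₂ (Diff (γ i)) (sym (g-γ i)) (sym (g-γ j))
      (inj₁ (γ-split i j (increasing-reflects-< γ-inc i j d<f)))
  g<apex : ∀ {d} → d ∈ range γ → g d <ᶠ e (fromℕ m)
  g<apex d∈Y with i , refl ← ∈-range⁻ γ d∈Y =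
    subst (_<ᶠ e (fromℕ m)) (sym (g-γ i)) (e-inc _ _ (inject₁<fromℕ i))
  g-inc : ∀ d f → d ∈ range γ → f ∈ range γ → d <ᶠ f → g d <ᶠ g f
  g-inc d f d∈Y f∈Y d<f with i , refl ← ∈-range⁻ γ d∈Y | j , refl ← ∈-range⁻ γ f∈Y =
    subst₂ _<ᶠ_ (sym (g-γ i)) (sym (g-γ j))
      (e-inc _ _ (inject₁-< i j (increasing-reflects-< γ-inc i j d<f)))

leftSection : ∀ {M m} {e : Fin (suc m) → Fin (2 ^ M)} → Increasing e → LeftComb {M} e →
  DepthSection {M} (range e) m
leftSection {M} {m} {e} e-inc comb = record
  { Y         = range γ
  ; ∣Y∣≡n     = ∣range∣ γ-injective
  ; apex      = e zero
  ; apex∈Z    = ∈-range⁺ e zero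
  ; g         = g
  ; g∈Z       = g∈Z
  ; apex-diff = apex-diff
  ; g-diff    = g-diff
  ; order     = inj₂ (apex<g , g-dec)
  }
  where
  open LeftComb comb
  g : Fin M → Fin (2 ^ M)
  g = extension γ (e ∘ suc) (e zero)
  g-γ : ∀ i → g (γ i) ≡ e (suc i)
  g-γ = extension-β γ-injective (e ∘ suc) (e zero)
  -- Since `γ` decreases, passing from depths to vertices reverses the order.
  reflect : ∀ i j → γ i <ᶠ γ j → j <ᶠ i
  reflect i j γi<γj with Fin.<-cmp i j
  ... | tri< i<j _ _  = contradiction (γ-dec i j i<j) (Fin.<-asym {x = γ i} {γ j} γi<γj)
  ... | tri≈ _ refl _ = contradiction γi<γj (Fin.<-irrefl {x = γ i} refl)
  ... | tri> _ _ j<i  = j<i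
  g∈Z : ∀ {d} → d ∈ range γ → g d ∈ range e
  g∈Z d∈Y with i , refl ← ∈-range⁻ γ d∈Y = subst (_∈ range e) (sym (g-γ i)) (∈-range⁺ e (suc i))
  apex-diff : ∀ {d} → d ∈ range γ → Diff d (g d) (e zero)
  apex-diff d∈Y with i , refl ← ∈-range⁻ γ d∈Y =
    subst (λ x → Diff (γ i) x (e zero)) (sym (g-γ i)) (inj₂ (γ-first i))
  g-diff : ∀ d f → d ∈ range γ → f ∈ range γ → d <ᶠ f → Diff d (g d) (g f)
  g-diff d f d∈Y f∈Y d<f with i , refl ← ∈-range⁻ γ d∈Y | j , refl ← ∈-range⁻ γ f∈Y =
    subst₂ (Diff (γ i)) (sym (g-γ i)) (sym (g-γ j)) (inj₂ (γ-split j i (reflect i j d<f)))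
  apex<g : ∀ {d} → d ∈ range γ → e zero <ᶠ g d
  apex<g d∈Y with i , refl ← ∈-range⁻ γ d∈Y =
    subst (e zero <ᶠ_) (sym (g-γ i)) (e-inc zero (suc i) (s≤s z≤n))
  g-dec : ∀ d f → d ∈ range γ → f ∈ range γ → d <ᶠ f → g f <ᶠ g d
  g-dec d f d∈Y f∈Y d<f with i , refl ← ∈-range⁻ γ d∈Y | j , refl ← ∈-range⁻ γ f∈Y =
    subst₂ _<ᶠ_ (sym (g-γ j)) (sym (g-γ i)) (e-inc _ _ (s≤s (reflect i j d<f)))

-- An order-preserving map of depths lifts to one of vertices that fixes the apex. Lifted sets have
-- the constant first key `b` and their original depth set as second key, so `StepUp` compares them
-- as `_≺_` compares the depth sets.
section-canonical : ∀ {M k n} {_≺_ : Rel [ M ]⁽ 2 + k ⁾ 0ℓ} {X Z : Subset (2 ^ M)} →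
  Canonical (StepUp {M} _≺_) X → Z ⊆ X →
  (b : Bool) → (∀ T → proj₁ T ⊆ Z → goesRight {M} {k} T ≡ b) →
  (σ : DepthSection {M} Z n) → Canonical _≺_ (DepthSection.Y σ)
section-canonical {M} {k} {_≺_ = _≺_} {X} {Z} canonical Z⊆X b constant σ
  A B A⊆Y B⊆Y _ f (f∈B , f-mono) S S′ T T′ S⊆A S′⊆A T-image T′-image S≺S′ =
  lower (transfer {_≺_ = StepUp {M} _≺_} canonical {α} {β}
    (λ i → Z⊆X (apex◂-∈Z α∈Y i)) (λ i → Z⊆X (apex◂-∈Z β∈Y i))
    (apex◂-injective α∈Y (increasing⇒injective (enum-increasing A)))
    (apex◂-monotone α∈Y β∈Y (enum-increasing A) β-inc)
    {index S S⊆A} {index S′ S′⊆A} (index-inj S S⊆A) (index-inj S′ S′⊆A)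
    {lift S S⊆Y} {lift S′ S′⊆Y} {lift T T⊆Y} {lift T′ T′⊆Y}
    (α∈lift S S⊆A S⊆Y) (β∈lift S T S⊆A T⊆Y T-image)
    (α∈lift S′ S′⊆A S′⊆Y) (β∈lift S′ T′ S′⊆A T′⊆Y T′-image) raise)
  where
  open DepthSection σ
  S⊆Y : proj₁ S ⊆ Y
  S⊆Y x∈S = A⊆Y (S⊆A x∈S)
  S′⊆Y : proj₁ S′ ⊆ Y
  S′⊆Y x∈S′ = A⊆Y (S′⊆A x∈S′)
  image⊆Y : ∀ (U V : [ M ]⁽ 2 + k ⁾) → proj₁ U ⊆ A → IsImage f (proj₁ U) (proj₁ V) → proj₁ V ⊆ Y
  image⊆Y U V U⊆A V-image {y} y∈V with x , x∈U , refl ← Equivalence.to (V-image y) y∈V = B⊆Y (f∈B (U⊆A x∈U))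
  T⊆Y : proj₁ T ⊆ Y
  T⊆Y = image⊆Y S T S⊆A T-image
  T′⊆Y : proj₁ T′ ⊆ Y
  T′⊆Y = image⊆Y S′ T′ S′⊆A T′-image

  α β : Fin (suc ∣ A ∣) → Fin (2 ^ M)
  α = apex◂ (enum A)
  β = apex◂ (f ∘ enum A)
  α∈Y : ∀ i → enum A i ∈ Y
  α∈Y i = A⊆Y (enum-∈ A i)
  β∈Y : ∀ i → f (enum A i) ∈ Y
  β∈Y i = B⊆Y (f∈B (enum-∈ A i))
  β-inc : Increasing (f ∘ enum A)
  β-inc i j i<j = f-mono (enum-∈ A i) (enum-∈ A j) (enum-increasing A i j i<j)

  position : ∀ (U : [ M ]⁽ 2 + k ⁾) → proj₁ U ⊆ A → ∀ t → ∃[ i ] enum A i ≡ elems U t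
  position U U⊆A t = enum-surjective A (U⊆A (elems-∈ U t))
  index : ∀ (U : [ M ]⁽ 2 + k ⁾) → proj₁ U ⊆ A → Fin (3 + k) → Fin (suc ∣ A ∣)
  index U U⊆A = zero ◂ (suc ∘ proj₁ ∘ position U U⊆A)
  index-inj : ∀ (U : [ M ]⁽ 2 + k ⁾) (U⊆A : proj₁ U ⊆ A) → Injective _≡_ _≡_ (index U U⊆A)
  index-inj U U⊆A {zero}  {zero}  _  = refl
  index-inj U U⊆A {suc s} {suc t} eq = cong suc (elems-injective U
    (trans (sym (proj₂ (position U U⊆A s)))
    (trans (cong (enum A) (Fin.suc-injective eq)) (proj₂ (position U U⊆A t)))))
  α∈lift : ∀ (U : [ M ]⁽ 2 + k ⁾) (U⊆A : proj₁ U ⊆ A) (U⊆Y : proj₁ U ⊆ Y) t →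
    α (index U U⊆A t) ∈ proj₁ (lift U U⊆Y)
  α∈lift U U⊆A U⊆Y zero    = apex∈lift U U⊆Y
  α∈lift U U⊆A U⊆Y (suc t) =
    g∈lift U U⊆Y (subst (_∈ proj₁ U) (sym (proj₂ (position U U⊆A t))) (elems-∈ U t))
  β∈lift : ∀ (U V : [ M ]⁽ 2 + k ⁾) (U⊆A : proj₁ U ⊆ A) (V⊆Y : proj₁ V ⊆ Y) →
    IsImage f (proj₁ U) (proj₁ V) → ∀ t → β (index U U⊆A t) ∈ proj₁ (lift V V⊆Y)
  β∈lift U V U⊆A V⊆Y V-image zero    = apex∈lift V V⊆Y
  β∈lift U V U⊆A V⊆Y V-image (suc t) = g∈lift V V⊆Y (Equivalence.from (V-image _)
    (_ , subst (_∈ proj₁ U) (sym (proj₂ (position U U⊆A t))) (elems-∈ U t) , refl))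

  lift-key : ∀ (U : [ M ]⁽ 2 + k ⁾) (U⊆Y : proj₁ U ⊆ Y) → setKey {M} (lift U U⊆Y) ≡ (b , [ U ])
  lift-key U U⊆Y = cong₂ _,_ (constant (lift U U⊆Y) (lift-⊆ U U⊆Y))
    (trans (cong (sized (2 + k)) (depthSet-lift U U⊆Y)) (sized-≡ U))
  raise : StepUp {M} _≺_ (lift S S⊆Y) (lift S′ S′⊆Y)
  raise = inj₁ (subst₂ (setLess _≺_) (sym (lift-key S S⊆Y)) (sym (lift-key S′ S′⊆Y))
    (inj₂ (refl , Infimum.[ S≺S′ ])))
  Below : SetKey M (2 + k) → SetKey M (2 + k) → Set
  Below p q = ×-Lex (_≈ₛ_ {M} {2 + k}) (setLess _≺_) (_<ₗ_ {2 ^ M})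
    (p , proj₁ (lift T T⊆Y)) (q , proj₁ (lift T′ T′⊆Y))
  -- Only the second key can decide: the first is `b` on both sides, and a tie forces `T ≡ T′`,
  -- which leaves the tie-breaker comparing a set with itself.
  unkey : Below (b , [ T ]) (b , [ T′ ]) → T ≺ T′
  unkey (inj₁ (inj₁ b<b)) = contradiction b<b (Bool.<-irrefl refl)
  unkey (inj₁ (inj₂ (_ , Infimum.[ T≺T′ ]))) = T≺T′
  unkey (inj₂ ((_ , eq) , _ , s)) = contradiction s (T≢T′ ([]-injective eq))
    where
    T≢T′ : ∀ {d} → T ≡ T′ → ¬ Split d (proj₁ (lift T T⊆Y)) (proj₁ (lift T′ T′⊆Y))
    -- The substitution is made in the range underlying `lift`, which does not depend on the proof
    -- of inclusion in `Y`.
    T≢T′ T≡T′ s = Split-irrefl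
      (subst (λ U → Split _ (range (apex◂ (elems U))) (proj₁ (lift T′ T′⊆Y))) T≡T′ s)
  lower : StepUp {M} _≺_ (lift T T⊆Y) (lift T′ T′⊆Y) → T ≺ T′
  lower lt = unkey (subst₂ Below (lift-key T T⊆Y) (lift-key T′ T′⊆Y) lt)

Witness : ∀ {M} k → Subset (2 ^ M) → Bool → Set
Witness {M} k Z b = Σ[ T ∈ [ 2 ^ M ]⁽ 3 + k ⁾ ] (proj₁ T ⊆ Z × goesRight {M} T ≡ b)

-- The alternative is decided by a search through the finitely many subsets.
constant-or-witness : ∀ {M k} (Z : Subset (2 ^ M)) (b : Bool) →
  (∀ (T : [ 2 ^ M ]⁽ 3 + k ⁾) → proj₁ T ⊆ Z → goesRight {M} T ≡ not b) ⊎ Witness {M} k Z b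
constant-or-witness {M} {k} Z b with anySubset? P?
  where
  P : Subset (2 ^ M) → Set
  P S = Σ[ ∣S∣ ∈ ∣ S ∣ ≡ 3 + k ] (S ⊆ Z × goesRight {M} (S , ∣S∣) ≡ b)
  P? : Decidable P
  P? S with ∣ S ∣ ℕ.≟ 3 + k
  ... | no  ∣S∣≢ = no (∣S∣≢ ∘ proj₁)
  ... | yes ∣S∣≡ = map′ (∣S∣≡ ,_)
    (λ (p , S⊆Z , eq) → S⊆Z , trans (cong (λ q → goesRight {M} (S , q)) (ℕ.≡-irrelevant ∣S∣≡ p)) eq)
    (S ⊆? Z ×-dec goesRight {M} (S , ∣S∣≡) Bool.≟ b)
... | yes (S , p , S⊆Z , eq) = inj₂ ((S , p) , S⊆Z , eq)
... | no  ∄ = inj₁ λ (S , p) S⊆Z → Bool.¬-not λ eq → ∄ (S , p , S⊆Z , eq)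

-- Otherwise both values occur in both sets: S₀ , S₁ ⊆ Z and S₀′ , S₁′ ⊆ Z′. Then
-- S₀ precedes S₁′ but S₀′ precedes S₁, although these pairs have the same pattern.
constant-on-one : ∀ {M k} {_≺_ : Rel [ M ]⁽ 2 + k ⁾ 0ℓ} → IsStrictTotalOrder _≡_ _≺_ →
  ∀ {X Z Z′ : Subset (2 ^ M)} → Canonical (StepUp {M} _≺_) X → Z ⊆ X → Z′ ⊆ X →
  (∀ {x y} → x ∈ Z → y ∈ Z′ → x <ᶠ y) →
  ∃[ b ] ((∀ (T : [ 2 ^ M ]⁽ 3 + k ⁾) → proj₁ T ⊆ Z  → goesRight {M} T ≡ b)
        ⊎ (∀ (T : [ 2 ^ M ]⁽ 3 + k ⁾) → proj₁ T ⊆ Z′ → goesRight {M} T ≡ b))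
constant-on-one {M} {k} {_≺_} sto {X} {Z} {Z′} canonical Z⊆X Z′⊆X Z<Z′
  with constant-or-witness {M} {k} Z false | constant-or-witness {M} {k} Z true
     | constant-or-witness {M} {k} Z′ false | constant-or-witness {M} {k} Z′ true
... | inj₁ c | _ | _ | _ = _ , inj₁ c
... | inj₂ _ | inj₁ c | _ | _ = _ , inj₁ c
... | inj₂ _ | inj₂ _ | inj₁ c | _ = _ , inj₂ c
... | inj₂ _ | inj₂ _ | inj₂ _ | inj₁ c = _ , inj₂ c
... | inj₂ (S₀ , S₀⊆Z , S₀≡) | inj₂ (S₁ , S₁⊆Z , S₁≡)
    | inj₂ (S₀′ , S₀′⊆Z′ , S₀′≡) | inj₂ (S₁′ , S₁′⊆Z′ , S₁′≡) =
  contradiction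
    (transfer-separated {_≺_ = StepUp {M} _≺_} canonical S₀ S₁′ S₁ S₀′
      (λ x∈ → Z⊆X (S₀⊆Z x∈)) (λ x∈ → Z′⊆X (S₁′⊆Z′ x∈)) (λ x∈ → Z⊆X (S₁⊆Z x∈)) (λ x∈ → Z′⊆X (S₀′⊆Z′ x∈))
      (λ x∈ y∈ → Z<Z′ (S₀⊆Z x∈) (S₁′⊆Z′ y∈)) (λ x∈ y∈ → Z<Z′ (S₁⊆Z x∈) (S₀′⊆Z′ y∈))
      (false-first S₀ S₁′ S₀≡ S₁′≡))
    (asym {S₀′} {S₁} (false-first S₀′ S₁ S₀′≡ S₁≡))
  where
  open IsStrictTotalOrder (StepUp-isStrictTotalOrder {M} sto) using (asym)
  false-first : ∀ (S T : [ 2 ^ M ]⁽ 3 + k ⁾) → goesRight {M} S ≡ false → goesRight {M} T ≡ true →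
    StepUp {M} _≺_ S T
  false-first S T S≡ T≡ = inj₁ (inj₁ (subst₂ Bool._<_ (sym S≡) (sym T≡) Bool.f<t))

-- Combs in a block of constant direction, and the final count

does≡true⇒ : ∀ {P : Set} (P? : Dec P) → does P? ≡ true → P
does≡true⇒ (yes p) _ = p

does≡false⇒¬ : ∀ {P : Set} (P? : Dec P) → does P? ≡ false → ¬ P
does≡false⇒¬ (no ¬p) _ = ¬p

-- Every triple of the first `suc m` vertices is completed by the last `k` ones to a set whose first
-- three elements are that triple, so `goesRight` reports its direction. All triples then agree, and
-- the front is a comb.
section-of-constant : ∀ {M k m} {e : Fin (suc m + k) → Fin (2 ^ M)} → Increasing e → (b : Bool) →
  (∀ (T : [ 2 ^ M ]⁽ 3 + k ⁾) → proj₁ T ⊆ range e → goesRight {M} T ≡ b) →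
  DepthSection {M} (range (e ∘ (_↑ˡ k))) m
section-of-constant {M} {k} {m} {e} e-inc b constant = by-value b refl
  where
  front : Fin (suc m) → Fin (2 ^ M)
  front i = e (i ↑ˡ k)
  back : Fin k → Fin (2 ^ M)
  back t = e (suc m ↑ʳ t)
  front-inc : Increasing front
  front-inc i j i<j = e-inc _ _ (subst₂ _<_ (sym (Fin.toℕ-↑ˡ i k)) (sym (Fin.toℕ-↑ˡ j k)) i<j)
  front<back : ∀ i t → front i <ᶠ back t
  front<back i t = e-inc _ _ (subst₂ _<_ (sym (Fin.toℕ-↑ˡ i k)) (sym (Fin.toℕ-↑ʳ (suc m) t))
    (ℕ.<-≤-trans (Fin.toℕ<n i) (ℕ.m≤m+n (suc m) (toℕ t))))
  back-inc : Increasing back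
  back-inc s t s<t = e-inc _ _ (subst₂ _<_ (sym (Fin.toℕ-↑ʳ (suc m) s)) (sym (Fin.toℕ-↑ʳ (suc m) t))
    (ℕ.+-monoʳ-< (suc m) s<t))
  direction : ∀ i j l → i <ᶠ j → j <ᶠ l → ∀ {c d : Fin M} →
    Splits c (front i) (front j) → Splits d (front j) (front l) → does (c Fin.<? d) ≡ b
  direction i j l i<j j<l s₀₁ s₁₂ =
    trans (sym (goesRight-≡ {M} H {h} h-inc (∈-range⁺ h) s₀₁ s₁₂)) (constant H (range-⊆ {h = h} h∈))
    where
    h : Fin (3 + k) → Fin (2 ^ M)
    h = front i ◂ front j ◂ front l ◂ back
    h-inc : Increasing h
    h-inc = ◂-increasing {h = front j ◂ front l ◂ back}
      (λ where zero          → front-inc i j i<j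
               (suc zero)    → front-inc i l (Fin.<-trans {i = i} {j} {l} i<j j<l)
               (suc (suc t)) → front<back i t)
      (◂-increasing {h = front l ◂ back}
        (λ where zero    → front-inc j l j<l
                 (suc t) → front<back j t)
        (◂-increasing {h = back} (front<back l) back-inc))
    h-inj : Injective _≡_ _≡_ h
    h-inj = increasing⇒injective h-inc
    H : [ 2 ^ M ]⁽ 3 + k ⁾
    H = kset h h-inj
    h∈ : ∀ t → h t ∈ range e
    h∈ zero                = ∈-range⁺ e (i ↑ˡ k)
    h∈ (suc zero)          = ∈-range⁺ e (j ↑ˡ k)
    h∈ (suc (suc zero))    = ∈-range⁺ e (l ↑ˡ k)
    h∈ (suc (suc (suc t))) = ∈-range⁺ e (suc m ↑ʳ t)
  by-value : ∀ b′ → b ≡ b′ → DepthSection {M} (range front) m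
  by-value true b≡ = rightSection {M} {m} {front} front-inc (rightComb {M} {m} {front} front-inc right)
    where
    right : Triples {M} _<ᶠ_ front
    right i j l i<j j<l {c} {d} s₀₁ s₁₂ =
      does≡true⇒ (c Fin.<? d) (trans (direction i j l i<j j<l s₀₁ s₁₂) b≡)
  by-value false b≡ = leftSection {M} {m} {front} front-inc (leftComb {M} {m} {front} front-inc left)
    where
    left : Triples {M} (λ c d → d <ᶠ c) front
    left i j l i<j j<l {c} {d} s₀₁ s₁₂ =
      -- A failed `c < d` gives only `d ≤ c`; equality is excluded because adjacent pairs never
      -- split at the same depth.
      Fin.≤∧≢⇒< (ℕ.≮⇒≥ (does≡false⇒¬ (c Fin.<? d) (trans (direction i j l i<j j<l s₀₁ s₁₂) b≡)))
        (≢-sym (Split-≢ s₀₁ s₁₂))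

-- A block needs `suc n` comb vertices for `n` depths and `k` vertices to complete triples. As
-- `suc k ≤ n`, it has at most 2n elements, which is the origin of the factor 4.
two-blocks-fit : ∀ n k → 3 + k ≤ n → (suc n + k) + (suc n + k) ≤ 4 * n + (3 + k)
two-blocks-fit n k 3+k≤n = begin
  (suc n + k) + (suc n + k) ≤⟨ ℕ.+-mono-≤ block block ⟩
  (n + n) + (n + n)         ≡⟨ solve 1 (λ n → (n :+ n) :+ (n :+ n) := con 4 :* n) refl n ⟩
  4 * n                     ≤⟨ ℕ.m≤m+n (4 * n) (3 + k) ⟩
  4 * n + (3 + k)           ∎
  where
  open ℕ.≤-Reasoning
  open +-*-Solver
  block : suc n + k ≤ n + n
  block = subst (_≤ n + n) (ℕ.+-suc n k) (ℕ.+-monoʳ-≤ n (ℕ.≤-trans (ℕ.m≤n+m (suc k) 2) 3+k≤n))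

canonical-section : ∀ {M k n} {_≺_ : Rel [ M ]⁽ 2 + k ⁾ 0ℓ} {X : Subset (2 ^ M)} →
  Canonical (StepUp {M} _≺_) X →
  {e : Fin (suc n + k) → Fin (2 ^ M)} → Increasing e → range e ⊆ X → (b : Bool) →
  (∀ (T : [ 2 ^ M ]⁽ 3 + k ⁾) → proj₁ T ⊆ range e → goesRight {M} T ≡ b) →
  Σ[ Y ∈ Subset M ] ∣ Y ∣ ≡ n × Canonical _≺_ Y
canonical-section {M} {k} {n} {_≺_} {X} canonical {e} e-inc e⊆X b constant =
  DepthSection.Y σ , DepthSection.∣Y∣≡n σ ,
  section-canonical {M} {k} {n} {_≺_} {X} {range front} canonical (λ x∈ → e⊆X (front⊆ x∈)) b
    (λ T T⊆ → constant T (λ x∈ → front⊆ (T⊆ x∈))) σ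
  where
  front : Fin (suc n) → Fin (2 ^ M)
  front i = e (i ↑ˡ k)
  σ : DepthSection {M} (range front) n
  σ = section-of-constant {M} {k} {n} {e} e-inc b constant
  front⊆ : range front ⊆ range e
  front⊆ = range-⊆ {h = front} (λ i → ∈-range⁺ e (i ↑ˡ k))

module Blocks {N p : ℕ} {e : Fin (p + p) → Fin N} (e-inc : Increasing e) where

  block₁ block₂ : Fin p → Fin N
  block₁ i = e (i ↑ˡ p)
  block₂ i = e (p ↑ʳ i)

  block₁-increasing : Increasing block₁
  block₁-increasing i j i<j = e-inc _ _ (subst₂ _<_ (sym (Fin.toℕ-↑ˡ i p)) (sym (Fin.toℕ-↑ˡ j p)) i<j)

  block₂-increasing : Increasing block₂
  block₂-increasing i j i<j =
    e-inc _ _ (subst₂ _<_ (sym (Fin.toℕ-↑ʳ p i)) (sym (Fin.toℕ-↑ʳ p j)) (ℕ.+-monoʳ-< p i<j))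

  block₁<block₂ : ∀ {y z} → y ∈ range block₁ → z ∈ range block₂ → y <ᶠ z
  block₁<block₂ y∈ z∈ with i , refl ← ∈-range⁻ block₁ y∈ | j , refl ← ∈-range⁻ block₂ z∈ =
    e-inc _ _ (subst₂ _<_ (sym (Fin.toℕ-↑ˡ i p)) (sym (Fin.toℕ-↑ʳ p j))
      (ℕ.<-≤-trans (Fin.toℕ<n i) (ℕ.m≤m+n p (toℕ j))))

blocks-section : ∀ {M k n} {_≺_ : Rel [ M ]⁽ 2 + k ⁾ 0ℓ} → IsStrictTotalOrder _≡_ _≺_ →
  {X : Subset (2 ^ M)} → Canonical (StepUp {M} _≺_) X →
  {e : Fin ((suc n + k) + (suc n + k)) → Fin (2 ^ M)} → Increasing e → (∀ i → e i ∈ X) →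
  Σ[ Y ∈ Subset M ] ∣ Y ∣ ≡ n × Canonical _≺_ Y
blocks-section {M} {k} {n} {_≺_} sto {X} canonical {e} e-inc e∈X =
  conclude (constant-on-one {M} {k} {_≺_} sto {X} {range block₁} {range block₂} canonical
    block₁⊆X block₂⊆X block₁<block₂)
  where
  open Blocks {p = suc n + k} {e = e} e-inc
  block₁⊆X : range block₁ ⊆ X
  block₁⊆X = range-⊆ {h = block₁} (λ i → e∈X _)
  block₂⊆X : range block₂ ⊆ X
  block₂⊆X = range-⊆ {h = block₂} (λ i → e∈X _)
  conclude : ∃[ b ] ((∀ (T : [ 2 ^ M ]⁽ 3 + k ⁾) → proj₁ T ⊆ range block₁ → goesRight {M} T ≡ b)
                   ⊎ (∀ (T : [ 2 ^ M ]⁽ 3 + k ⁾) → proj₁ T ⊆ range block₂ → goesRight {M} T ≡ b)) →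
    Σ[ Y ∈ Subset M ] ∣ Y ∣ ≡ n × Canonical _≺_ Y
  conclude (b , inj₁ constant) =
    canonical-section {M} {k} {n} {_≺_} {X} canonical {block₁} block₁-increasing block₁⊆X b constant
  conclude (b , inj₂ constant) =
    canonical-section {M} {k} {n} {_≺_} {X} canonical {block₂} block₂-increasing block₂⊆X b constant

-- The stepping-up construction in contrapositive form: canonical sets for the stepped-up ordering
-- on `2 ^ M` project to canonical sets of depths.
hasCanonicalSubsets-stepDown : ∀ n k M → 3 + k ≤ n →
  HasCanonicalSubsets (3 + k) (4 * n + (3 + k)) (2 ^ M) → HasCanonicalSubsets (2 + k) n M
hasCanonicalSubsets-stepDown n k M 3+k≤n good _≺_ sto =
  let X , ∣X∣≡ , canonical = good (StepUp {M} _≺_) (StepUp-isStrictTotalOrder {M} sto)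
      e = elems (X , ∣X∣≡)
      fit = two-blocks-fit n k 3+k≤n
  -- The two blocks are taken from the beginning of `X`.
  in blocks-section {M} {k} {n} {_≺_} sto {X} canonical {λ i → e (Fin.inject≤ i fit)}
       (λ i j i<j → elems-increasing (X , ∣X∣≡) _ _
         (subst₂ _<_ (sym (Fin.toℕ-inject≤ i fit)) (sym (Fin.toℕ-inject≤ j fit)) i<j))
       (λ i → elems-∈ (X , ∣X∣≡) _)

-- An empty ground set carries an ordering but has no nonempty subset. This excludes `L′ = 0`, so
-- the truncated `L′ ∸ 1` is a true predecessor.
¬hasCanonicalSubsets-0 : ∀ n k → ¬ HasCanonicalSubsets k (suc n) 0
¬hasCanonicalSubsets-0 n k good
  with good (_<ₗ_ on proj₁) (pullback <ₗ-isStrictTotalOrder proj₁ kset-≡)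
... | [] , () , _

theorem1p3 : ((n R : ℕ) → 4 ≤ n → 1 ≤ R → R ↛⟨ n ∸ 1 ⟩²₂ →
    (L : ℕ) → IsL 2 n L → L > 2 ^ R)
    × ((n k : ℕ) → k ≤ n → 3 ≤ k →
    (L L′ : ℕ) → IsL k (4 * n + k) L → IsL (k ∸ 1) n L′ → L > 2 ^ (L′ ∸ 1))
theorem1p3 = pairs , stepUp
  where
  pairs : (n R : ℕ) → 4 ≤ n → 1 ≤ R → R ↛⟨ n ∸ 1 ⟩²₂ → (L : ℕ) → IsL 2 n L → L > 2 ^ R
  pairs (suc (suc (suc m))) R (s≤s (s≤s (s≤s _))) _ (χ , ¬mono) L (good , _) = ℕ.≰⇒> λ L≤2^R →
    -- If `L ≤ 2 ^ R`, the ordering built from `χ` on `2 ^ R` points has a canonical set of size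
    -- `3 + m`, whose `2 + m` depths contradict the choice of `χ`.
    let X , ∣X∣≡ , canonical = good (2 ^ R) L≤2^R (KeyOrder _≈ₚ_ _<ₚ_ (pairKey χ))
                                 (KeyOrder-isStrictTotalOrder <ₚ-isStrictTotalOrder (pairKey χ))
    in ¬mono (canonical-pairs⇒monochromatic m χ ∣X∣≡ canonical)

  stepUp : (n k : ℕ) → k ≤ n → 3 ≤ k →
    (L L′ : ℕ) → IsL k (4 * n + k) L → IsL (k ∸ 1) n L′ → L > 2 ^ (L′ ∸ 1)
  stepUp (suc n) (suc (suc (suc k))) k≤n (s≤s (s≤s (s≤s _))) L zero _ (good′ , _) =
    contradiction (good′ 0 z≤n) (¬hasCanonicalSubsets-0 n (2 + k))
  stepUp n (suc (suc (suc k))) k≤n (s≤s (s≤s (s≤s _))) L (suc M) (good , _) (good′ , least) =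
    -- If `L ≤ 2 ^ M`, then already `M` has the defining property of `L′ = suc M`, against
    -- minimality.
    ℕ.≰⇒> λ L≤2^M → ℕ.1+n≰n (least M (goodFrom L≤2^M))
    where
    goodFrom : L ≤ 2 ^ M → ∀ N → M ≤ N → HasCanonicalSubsets (2 + k) n N
    -- Above `M` the property is known from `L′`; stepping down supplies the single case `N = M`.
    goodFrom L≤2^M N M≤N with ℕ.m≤n⇒m<n∨m≡n M≤N
    ... | inj₁ M<N  = good′ N M<N
    ... | inj₂ refl = hasCanonicalSubsets-stepDown n k M k≤n (good (2 ^ M) L≤2^M)
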